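{- Let $n\ge 1$, let $\Phi=\{f_1,\ldots,f_k\}$ be a finite subset of the free MV-algebra $\mathbf{F}_n$ and let $\beta:\Phi\to[0,1]$ be a book on $\Phi$. Then the following conditions are equivalent: (1) $\beta$ is strictly coherent; (2) $\beta$ extends to a faithful state of $\mathbf{F}_n$, i.e. there is a faithful state $s$ of $\mathbf{F}_n$ with $s(f)=\beta(f)$ for all $f\in\Phi$.
   Context: $\mathbf{F}_n$ is the free $n$-generated MV-algebra, identified with the algebra of all $n$-variable McNaughton functions: continuous functions $f:[0,1]^n\to[0,1]$ that are piecewise linear (affine) with finitely many pieces, each piece having integer coefficients. The operations are pointwise, with $x\oplus y=\min\{1,x+y\}$, $\neg x=1-x$, $x\odot y=\max\{0,x+y-1\}$ on $[0,1]$; $0$ and $1$ are the constant functions. Homomorphisms of $\mathbf{F}_n$ into the standard MV-algebra $[0,1]$ (valuations of Łukasiewicz logic) are exactly the evaluations $f\mapsto f(x)$ at points $x\in[0,1]^n$. A book on $\Phi=\{f_1,\ldots,f_k\}$ is a map $\beta:\Phi\to[0,1]$. It is strictly coherent if for all $\sigma_1,\ldots,\sigma_k\in\mathbb{R}$, the existence of $x\in[0,1]^n$ with $\sum_{i=1}^k\sigma_i(\beta(f_i)-f_i(x))<0$ implies the existence of $x'\in[0,1]^n$ with $\sum_{i=1}^k\sigma_i(\beta(f_i)-f_i(x'))>0$. A state of an MV-algebra $\mathbf{A}$ is a map $s:A\to[0,1]$ with $s(1)=1$ and $s(a\oplus b)=s(a)+s(b)$ whenever $a\odot b=0$. A state $s$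 is faithful if $s(a)\neq 0$ for all $a\neq 0$. -}

module Defs where

open import Algebra.Bundles using (CommutativeRing)
import Algebra.Construct.NaturalChoice.Max as Max
import Algebra.Construct.NaturalChoice.Min as Min
import Algebra.Definitions.RawMonoid as RawMonoidDefinitions
import Algebra.Properties.CommutativeMonoid.Sum as SumProperties
import Algebra.Properties.CommutativeSemigroup as CommutativeSemigroupProperties
import Algebra.Properties.Ring as RingProperties
import Algebra.Properties.Semiring.Mult as MultProperties
import Algebra.Solver.Ring as RingSolver
open import Algebra.Solver.Ring.AlmostCommutativeRing
  using (AlmostCommutativeRing; fromCommutativeRing; _-Raw-AlmostCommutative⟶_)
open import Algebra.Structures using (IsCommutativeMonoid)
open import Data.Fin.Base as Fin using ()
open import Data.Integer.Base using (ℤ; +_; -[1+_]; _⊖_)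
import Data.Integer.Base as ℤ
import Data.Integer.Properties as ℤ
open import Data.List.Base using (List; []; _∷_; map; cartesianProductWith)
open import Data.List.Relation.Unary.Any as Any using (Any; here; there)
open import Data.List.Relation.Unary.Any.Properties using (map⁺; cartesianProductWith⁺)
import Data.Maybe.Base as Maybe
open import Data.Nat.Base as ℕ using (ℕ; zero; suc)
import Data.Nat.Properties as ℕ
open import Data.Product.Base using (Σ; ∃; _×_; _,_; proj₁; proj₂)
open import Data.Sum.Base using (inj₁; inj₂)
open import Data.Vec.Functional using (Vector)
import Data.Vec.Functional.Relation.Binary.Equality.Setoid as VectorEquality
open import Function.Bundles using (Func)
import Level as L
open L using (0ℓ)
open import Relation.Binary.Bundles using (Setoid; TotalOrder)
import Relation.Binary.Construct.NonStrictToStrict as NonStrictToStrict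
import Relation.Binary.Construct.On as On
open import Relation.Binary.Core using (Rel)
import Relation.Binary.PropositionalEquality.Core as ≡
open import Relation.Binary.Structures using (IsTotalOrder)
open import Relation.Nullary.Decidable.Core using (dec⇒maybe)
open import Relation.Nullary.Negation using (contradiction)
open import Relation.Unary using (Pred; Satisfiable)

-- The real numbers enter through their categorical axiomatisation:
-- everything below is stated for an arbitrary Dedekind-complete
-- ordered field, which classically is unique up to isomorphism.

record CompleteOrderedField : Set₁ where
  infix 4 _≤_
  field
    commutativeRing : CommutativeRing 0ℓ 0ℓ
  open CommutativeRing commutativeRing public
  field
    0#≉1#        : 0# ≉ 1#
    inverse      : ∀ x → x ≉ 0# → ∃ λ y → x * y ≈ 1#
    _≤_          : Rel Carrier 0ℓ
    isTotalOrder : IsTotalOrder _≈_ _≤_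
    +-monoʳ-≤    : ∀ x {y z} → y ≤ z → x + y ≤ x + z
    *-nonneg     : ∀ {x y} → 0# ≤ x → 0# ≤ y → 0# ≤ x * y

  UpperBound : Pred Carrier 0ℓ → Pred Carrier 0ℓ
  UpperBound P u = ∀ {x} → P x → x ≤ u

  field
    supremum : ∀ P → Satisfiable P → Satisfiable (UpperBound P) →
               ∃ λ s → UpperBound P s × (∀ {u} → UpperBound P u → s ≤ u)

  totalOrder : TotalOrder 0ℓ 0ℓ 0ℓ
  totalOrder = record { isTotalOrder = isTotalOrder }

  open NonStrictToStrict _≈_ _≤_ public using (_<_)
  open Min totalOrder public using (_⊓_)
  open Max totalOrder public using (_⊔_)
  open RawMonoidDefinitions +-rawMonoid public using (sum) renaming (_×_ to _·_)

  ∣_∣ : Carrier → Carrier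
  ∣ x ∣ = x ⊔ (- x)

  fromℤ : ℤ → Carrier
  fromℤ (+ n)    = n · 1#
  fromℤ -[1+ n ] = - (suc n · 1#)

record MVAlgebra c ℓ : Set (L.suc (c L.⊔ ℓ)) where
  infix  4 _≈_
  infixl 6 _⊕_
  infixl 7 _⊙_
  infix  8 ¬_
  field
    Carrier             : Set c
    _≈_                 : Rel Carrier ℓ
    _⊕_                 : Carrier → Carrier → Carrier
    ¬_                  : Carrier → Carrier
    𝟘                   : Carrier
    isCommutativeMonoid : IsCommutativeMonoid _≈_ _⊕_ 𝟘
    ¬-cong              : ∀ {x y} → x ≈ y → ¬ x ≈ ¬ y
    ¬-involutive        : ∀ x → ¬ ¬ x ≈ x
    ⊕-zeroʳ             : ∀ x → x ⊕ ¬ 𝟘 ≈ ¬ 𝟘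
    łukasiewicz         : ∀ x y → ¬ (¬ x ⊕ y) ⊕ y ≈ ¬ (¬ y ⊕ x) ⊕ x

  open IsCommutativeMonoid isCommutativeMonoid public using (setoid)
  open Setoid setoid public using (_≉_)

  𝟙 : Carrier
  𝟙 = ¬ 𝟘

  _⊙_ : Carrier → Carrier → Carrier
  x ⊙ y = ¬ (¬ x ⊕ ¬ y)

module OrderedFieldProperties (ℝ : CompleteOrderedField) where
  open CompleteOrderedField ℝ
  open TotalOrder totalOrder public
    using (total; antisym; ≤-respˡ-≈; ≤-respʳ-≈)
    renaming (refl to ≤-refl; trans to ≤-trans; reflexive to ≤-reflexive)
  open Min totalOrder public using
    (⊓-cong; ⊓-glb; x⊓y≤x; x⊓y≤y; x≤y⇒x⊓y≈x)
    renaming (x≤y⇒y⊓x≈x to x≥y⇒x⊓y≈y)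
  open Max totalOrder public using
    (⊔-cong; ⊔-lub; x≤x⊔y; x≤y⊔x; x≤y⇒x⊔y≈y)
    renaming (x≤y⇒y⊔x≈y to x≥y⇒x⊔y≈x)
  open RingProperties ring public using (+-cancelˡ; -‿involutive)
    renaming (-0#≈0# to -0≈0)
  open RingProperties ring using (-‿+-comm; -‿distribˡ-*; -‿distribʳ-*)
  open MultProperties semiring using (×-homo-+; ×1-homo-*)
  open CommutativeSemigroupProperties +-commutativeSemigroup using (interchange)

  fromℤ-⊖ : ∀ m n → fromℤ (m ⊖ n) ≈ m · 1# - n · 1#
  fromℤ-⊖ zero    zero    = sym (-‿inverseʳ 0#)
  fromℤ-⊖ zero    (suc n) = sym (+-identityˡ _)
  fromℤ-⊖ (suc m) zero    = sym (trans (+-congˡ -0≈0) (+-identityʳ _))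
  fromℤ-⊖ (suc m) (suc n) = trans (reflexive (≡.cong fromℤ (ℤ.[1+m]⊖[1+n]≡m⊖n m n)))
    (trans (fromℤ-⊖ m n) (sym
    (trans (+-congˡ (sym (-‿+-comm 1# _)))
    (trans (interchange 1# _ (- 1#) _)
    (trans (+-congʳ (-‿inverseʳ 1#)) (+-identityˡ _))))))

  fromℤ-homo-+ : ∀ i j → fromℤ (i ℤ.+ j) ≈ fromℤ i + fromℤ j
  fromℤ-homo-+ (+ m)    (+ n)    = ×-homo-+ 1# m n
  fromℤ-homo-+ (+ m)    -[1+ n ] = fromℤ-⊖ m (suc n)
  fromℤ-homo-+ -[1+ m ] (+ n)    = trans (fromℤ-⊖ n (suc m)) (+-comm _ _)
  fromℤ-homo-+ -[1+ m ] -[1+ n ] = trans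
    (-‿cong (trans (reflexive (≡.cong (_· 1#) (≡.cong suc (≡.sym (ℕ.+-suc m n)))))
                   (×-homo-+ 1# (suc m) (suc n))))
    (sym (-‿+-comm _ _))

  fromℤ-homo-neg : ∀ i → fromℤ (ℤ.- i) ≈ - fromℤ i
  fromℤ-homo-neg (+ zero)  = sym -0≈0
  fromℤ-homo-neg (+ suc n) = refl
  fromℤ-homo-neg -[1+ n ]  = sym (-‿involutive _)

  private
    fromℤ-homo-ℕ* : ∀ m j → fromℤ (+ m ℤ.* j) ≈ fromℤ (+ m) * fromℤ j
    fromℤ-homo-ℕ* m (+ n) =
      trans (reflexive (≡.cong fromℤ (≡.sym (ℤ.pos-* m n)))) (×1-homo-* m n)
    fromℤ-homo-ℕ* m -[1+ n ] =
      trans (reflexive (≡.cong fromℤ (≡.sym (ℤ.neg-distribʳ-* (+ m) (+ suc n)))))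
      (trans (fromℤ-homo-neg (+ m ℤ.* + suc n))
      (trans (-‿cong (fromℤ-homo-ℕ* m (+ suc n))) (-‿distribʳ-* _ _)))

  fromℤ-homo-* : ∀ i j → fromℤ (i ℤ.* j) ≈ fromℤ i * fromℤ j
  fromℤ-homo-* (+ m)    j = fromℤ-homo-ℕ* m j
  fromℤ-homo-* -[1+ m ] j =
    trans (reflexive (≡.cong fromℤ (≡.sym (ℤ.neg-distribˡ-* (+ suc m) j))))
    (trans (fromℤ-homo-neg (+ suc m ℤ.* j))
    (trans (-‿cong (fromℤ-homo-ℕ* (suc m) j)) (-‿distribˡ-* _ _)))

  almostCommutativeRing : AlmostCommutativeRing 0ℓ 0ℓ
  almostCommutativeRing = fromCommutativeRing commutativeRing

  fromℤ-morphism : ℤ.+-*-rawRing -Raw-AlmostCommutative⟶ almostCommutativeRing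
  fromℤ-morphism = record
    { ⟦_⟧    = fromℤ
    ; +-homo = fromℤ-homo-+
    ; *-homo = fromℤ-homo-*
    ; -‿homo = fromℤ-homo-neg
    ; 0-homo = refl
    ; 1-homo = +-identityʳ 1#
    }

  open RingSolver ℤ.+-*-rawRing almostCommutativeRing fromℤ-morphism
    (λ i j → Maybe.map (λ i≡j → reflexive (≡.cong fromℤ i≡j)) (dec⇒maybe (i ℤ.≟ j))) public
    using (solve; con; _:+_; _:*_; _:-_; :-_; _:=_)

  <-≤-trans : ∀ {x y z} → x < y → y ≤ z → x < z
  <-≤-trans (x≤y , x≉y) y≤z =
    ≤-trans x≤y y≤z , λ x≈z → x≉y (antisym x≤y (≤-respʳ-≈ (sym x≈z) y≤z))

  ≤-<-trans : ∀ {x y z} → x ≤ y → y < z → x < z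
  ≤-<-trans x≤y (y≤z , y≉z) =
    ≤-trans x≤y y≤z , λ x≈z → y≉z (antisym y≤z (≤-respˡ-≈ x≈z x≤y))

  <-resp-≈ : ∀ {x y u v} → x ≈ u → y ≈ v → x < y → u < v
  <-resp-≈ x≈u y≈v x<y =
    <-≤-trans (≤-<-trans (≤-reflexive (sym x≈u)) x<y) (≤-reflexive y≈v)

  +-monoˡ-≤ : ∀ x {y z} → y ≤ z → y + x ≤ z + x
  +-monoˡ-≤ x y≤z =
    ≤-respˡ-≈ (+-comm x _) (≤-respʳ-≈ (+-comm x _) (+-monoʳ-≤ x y≤z))

  +-mono-≤ : ∀ {x y u v} → x ≤ y → u ≤ v → x + u ≤ y + v
  +-mono-≤ x≤y u≤v = ≤-trans (+-monoˡ-≤ _ x≤y) (+-monoʳ-≤ _ u≤v)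

  +-monoʳ-< : ∀ x {y z} → y < z → x + y < x + z
  +-monoʳ-< x (y≤z , y≉z) = +-monoʳ-≤ x y≤z , λ eq → y≉z (+-cancelˡ x _ _ eq)

  +-monoˡ-< : ∀ x {y z} → y < z → y + x < z + x
  +-monoˡ-< x y<z = <-resp-≈ (+-comm x _) (+-comm x _) (+-monoʳ-< x y<z)

  +-mono-< : ∀ {x y u v} → x < y → u < v → x + u < y + v
  +-mono-< x<y u<v = <-≤-trans (+-monoˡ-< _ x<y) (+-monoʳ-≤ _ (proj₁ u<v))

  -‿anti-≤ : ∀ {x y} → x ≤ y → - y ≤ - x
  -‿anti-≤ {x} {y} x≤y =
    ≤-respˡ-≈ (solve 2 (λ x y → ((:- x) :+ (:- y)) :+ x := :- y) refl x y)
    (≤-respʳ-≈ (solve 2 (λ x y → ((:- x) :+ (:- y)) :+ y := :- x) refl x y)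
    (+-monoʳ-≤ (- x + - y) x≤y))

  0≤1 : 0# ≤ 1#
  0≤1 with total 0# 1#
  ... | inj₁ 0≤1 = 0≤1
  ... | inj₂ 1≤0 = ≤-respʳ-≈ -1*-1≈1 (*-nonneg 0≤-1 0≤-1)
    where
    0≤-1 : 0# ≤ - 1#
    0≤-1 = ≤-respˡ-≈ (-‿inverseˡ 1#) (≤-respʳ-≈ (+-identityʳ _) (+-monoʳ-≤ (- 1#) 1≤0))
    -1*-1≈1 : - 1# * - 1# ≈ 1#
    -1*-1≈1 = trans (solve 1 (λ x → (:- x) :* (:- x) := x :* x) refl 1#) (*-identityˡ 1#)

  x≤x+y : ∀ {x y} → 0# ≤ y → x ≤ x + y
  x≤x+y 0≤y = ≤-respˡ-≈ (+-identityʳ _) (+-monoʳ-≤ _ 0≤y)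

  x<x+y : ∀ {x y} → 0# < y → x < x + y
  x<x+y 0<y = <-resp-≈ (+-identityʳ _) refl (+-monoʳ-< _ 0<y)

  ⊓-pos : ∀ {x y} → 0# < x → 0# < y → 0# < x ⊓ y
  ⊓-pos {x} {y} 0<x 0<y with total x y
  ... | inj₁ x≤y = 0<x
  ... | inj₂ y≤x = 0<y

  ⊔-lub-< : ∀ {x y z} → x < z → y < z → x ⊔ y < z
  ⊔-lub-< {x} {y} x<z y<z with total y x
  ... | inj₁ y≤x = x<z
  ... | inj₂ x≤y = y<z

  half : ∀ {ε} → 0# < ε → ∃ λ δ → 0# < δ × δ + δ ≈ ε
  half {ε} (0≤ε , 0≉ε) = ε * h , (0≤εh , 0≉εh) , εh+εh≈ε
    where
    1≤2 = x≤x+y {1#} 0≤1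
    2≉0 : 1# + 1# ≉ 0#
    2≉0 2≈0 = 0#≉1# (antisym 0≤1 (≤-respʳ-≈ 2≈0 1≤2))
    h = proj₁ (inverse (1# + 1#) 2≉0)
    2h≈1 = proj₂ (inverse (1# + 1#) 2≉0)
    0≤h : 0# ≤ h
    0≤h with total 0# h
    ... | inj₁ 0≤h = 0≤h
    ... | inj₂ h≤0 = contradiction (antisym 0≤1 1≤0) 0#≉1#
      where
      h+h≈1 : h + h ≈ 1#
      h+h≈1 = trans (sym (trans (distribʳ h 1# 1#) (+-cong (*-identityˡ h) (*-identityˡ h)))) 2h≈1
      1≤0 : 1# ≤ 0#
      1≤0 = ≤-respˡ-≈ h+h≈1 (≤-respʳ-≈ (+-identityʳ 0#) (+-mono-≤ h≤0 h≤0))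
    εh+εh≈ε : ε * h + ε * h ≈ ε
    εh+εh≈ε = trans (sym (distribˡ ε h h))
      (trans (*-congˡ (trans (sym (+-cong (*-identityˡ h) (*-identityˡ h)))
                             (trans (sym (distribʳ h 1# 1#)) 2h≈1)))
             (*-identityʳ ε))
    0≤εh = *-nonneg 0≤ε 0≤h
    0≉εh : 0# ≉ ε * h
    0≉εh eq = 0≉ε (trans (sym (+-identityʳ 0#)) (trans (+-cong eq eq) εh+εh≈ε))

  ∣x-y∣<ε⇒x<y+ε : ∀ {x y ε} → ∣ x - y ∣ < ε → x < y + ε
  ∣x-y∣<ε⇒x<y+ε {x} {y} lt =
    <-resp-≈ (solve 2 (λ x y → y :+ (x :+ (:- y)) := x) refl x y) refl
             (+-monoʳ-< y (≤-<-trans (x≤x⊔y _ _) lt))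

  ∣x-y∣<ε⇒y<x+ε : ∀ {x y ε} → ∣ x - y ∣ < ε → y < x + ε
  ∣x-y∣<ε⇒y<x+ε {x} {y} lt =
    <-resp-≈ (solve 2 (λ x y → x :+ (:- (x :+ (:- y))) := y) refl x y) refl
             (+-monoʳ-< x (≤-<-trans (x≤y⊔x _ _) lt))

  x<y+ε∧y<x+ε⇒∣x-y∣<ε : ∀ {x y ε} → x < y + ε → y < x + ε → ∣ x - y ∣ < ε
  x<y+ε∧y<x+ε⇒∣x-y∣<ε {x} {y} {ε} x<y+ε y<x+ε = ⊔-lub-<
    (<-resp-≈ (+-comm (- y) x) (solve 2 (λ y e → (:- y) :+ (y :+ e) := e) refl y ε)
              (+-monoʳ-< (- y) x<y+ε))
    (<-resp-≈ (solve 2 (λ x y → (:- x) :+ y := :- (x :+ (:- y))) refl x y)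
              (solve 2 (λ x e → (:- x) :+ (x :+ e) := e) refl x ε)
              (+-monoʳ-< (- x) y<x+ε))

module McNaughtonFunctions (ℝ : CompleteOrderedField) where
  open CompleteOrderedField ℝ
  open OrderedFieldProperties ℝ
  open SumProperties +-commutativeMonoid using (sum-cong-≋; ∑-distrib-+; sum-replicate-zero)

  -- Function equality in the classical reading is pointwise, so [0,1], its
  -- powers and 𝐅 n are setoids, and maps between them respect equality.
  [0,1] : Setoid 0ℓ 0ℓ
  [0,1] = record
    { Carrier       = ∃ λ x → 0# ≤ x × x ≤ 1#
    ; _≈_           = λ x y → proj₁ x ≈ proj₁ y
    ; isEquivalence = On.isEquivalence proj₁ isEquivalence
    }

  𝕀 : Set
  𝕀 = Setoid.Carrier [0,1]

  standard : MVAlgebra 0ℓ 0ℓ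
  standard = record
    { Carrier             = 𝕀
    ; _≈_                 = _≋_
    ; _⊕_                 = _⊕_
    ; ¬_                  = ¬_
    ; 𝟘                   = 0# , ≤-refl , 0≤1
    ; isCommutativeMonoid = record
      { isMonoid = record
        { isSemigroup = record
          { isMagma = record
            { isEquivalence = Setoid.isEquivalence [0,1]
            ; ∙-cong        = λ x≈u y≈v → ⊓-cong refl (+-cong x≈u y≈v)
            }
          ; assoc = ⊕-assoc
          }
        ; identity = (λ x → trans (⊓-cong refl (+-identityˡ _)) (1⊓x≈x x))
                   , (λ x → trans (⊓-cong refl (+-identityʳ _)) (1⊓x≈x x))
        }
      ; comm = λ x y → ⊓-cong refl (+-comm (proj₁ x) (proj₁ y))
      }
    ; ¬-cong       = λ x≈y → +-congˡ (-‿cong x≈y)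
    ; ¬-involutive = λ x → 1-[1-x]≈x (proj₁ x)
    ; ⊕-zeroʳ      = λ x → trans (x≤y⇒x⊓y≈x (1≤x+[1-0] x)) (sym 1-0≈1)
    ; łukasiewicz  = łuk
    }
    where
    open Setoid [0,1] using () renaming (_≈_ to _≋_)
    infixl 6 _⊕_
    infix  8 ¬_

    _⊕_ : 𝕀 → 𝕀 → 𝕀
    (x , 0≤x , x≤1) ⊕ (y , 0≤y , y≤1) =
      1# ⊓ (x + y) , ⊓-glb 0≤1 (≤-trans 0≤x (x≤x+y 0≤y)) , x⊓y≤x _ _

    ¬_ : 𝕀 → 𝕀
    ¬ (x , 0≤x , x≤1) =
        1# - x
      , ≤-respˡ-≈ (-‿inverseʳ x) (+-monoˡ-≤ (- x) x≤1)
      , ≤-respʳ-≈ (solve 2 (λ o x → (o :+ (:- x)) :+ x := o) refl 1# x) (x≤x+y 0≤x)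

    1⊓x≈x : ∀ x → 1# ⊓ proj₁ x ≈ proj₁ x
    1⊓x≈x (x , 0≤x , x≤1) = x≥y⇒x⊓y≈y x≤1

    1-[1-x]≈x : ∀ x → 1# - (1# - x) ≈ x
    1-[1-x]≈x = solve 2 (λ o x → o :+ (:- (o :+ (:- x))) := x) refl 1#

    1-0≈1 : 1# - 0# ≈ 1#
    1-0≈1 = trans (+-congˡ -0≈0) (+-identityʳ 1#)

    1≤x+[1-0] : ∀ x → 1# ≤ proj₁ x + (1# - 0#)
    1≤x+[1-0] (x , 0≤x , x≤1) =
      ≤-respʳ-≈ (trans (+-comm 1# x) (+-congˡ (sym 1-0≈1))) (x≤x+y 0≤x)

    ⊓-absorb : ∀ {u} z → 0# ≤ z → 1# ⊓ ((1# ⊓ u) + z) ≈ 1# ⊓ (u + z)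
    ⊓-absorb {u} z 0≤z with total 1# u
    ... | inj₁ 1≤u = trans (x≤y⇒x⊓y≈x (x≤x+y 0≤z))
                           (sym (x≤y⇒x⊓y≈x (≤-trans 1≤u (x≤x+y 0≤z))))
    ... | inj₂ u≤1 = refl

    ⊕-assoc : ∀ x y z → (x ⊕ y) ⊕ z ≋ x ⊕ (y ⊕ z)
    ⊕-assoc (x , 0≤x , _) (y , _) (z , 0≤z , _) =
      trans (⊓-absorb z 0≤z)
      (trans (⊓-cong refl (trans (+-assoc x y z) (+-comm x (y + z))))
      (trans (sym (⊓-absorb x 0≤x)) (⊓-cong refl (+-comm _ x))))

    x≤y⇒[x→y]→y : ∀ x y → proj₁ x ≤ proj₁ y → ¬ (¬ x ⊕ y) ⊕ y ≋ y
    x≤y⇒[x→y]→y 𝐱@(x , _) 𝐲@(y , _) x≤y = trans (⊓-cong refl eq) (1⊓x≈x 𝐲)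
      where
      1≤1-x+y : 1# ≤ (1# - x) + y
      1≤1-x+y = ≤-respˡ-≈ (solve 2 (λ o x → (o :+ (:- x)) :+ x := o) refl 1# x)
                          (+-monoʳ-≤ (1# - x) x≤y)
      eq : (1# - (1# ⊓ ((1# - x) + y))) + y ≈ y
      eq = trans (+-congʳ (trans (+-congˡ (-‿cong (x≤y⇒x⊓y≈x 1≤1-x+y))) (-‿inverseʳ 1#)))
                 (+-identityˡ y)

    x≤y⇒[y→x]→x : ∀ x y → proj₁ x ≤ proj₁ y → ¬ (¬ y ⊕ x) ⊕ x ≋ y
    x≤y⇒[y→x]→x 𝐱@(x , _) 𝐲@(y , _) x≤y = trans (⊓-cong refl eq) (1⊓x≈x 𝐲)
      where
      1-y+x≤1 : (1# - y) + x ≤ 1#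
      1-y+x≤1 = ≤-respʳ-≈ (solve 2 (λ o y → (o :+ (:- y)) :+ y := o) refl 1# y)
                          (+-monoʳ-≤ (1# - y) x≤y)
      eq : (1# - (1# ⊓ ((1# - y) + x))) + x ≈ y
      eq = trans (+-congʳ (+-congˡ (-‿cong (x≥y⇒x⊓y≈y 1-y+x≤1))))
        (solve 3 (λ o x y → (o :+ (:- ((o :+ (:- y)) :+ x))) :+ x := y) refl 1# x y)

    łuk : ∀ x y → ¬ (¬ x ⊕ y) ⊕ y ≋ ¬ (¬ y ⊕ x) ⊕ x
    łuk x y with total (proj₁ x) (proj₁ y)
    ... | inj₁ x≤y = trans (x≤y⇒[x→y]→y x y x≤y) (sym (x≤y⇒[y→x]→x x y x≤y))
    ... | inj₂ y≤x = trans (x≤y⇒[y→x]→x y x y≤x) (sym (x≤y⇒[x→y]→y y x y≤x))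

  standard-𝟙 : proj₁ (MVAlgebra.𝟙 standard) ≈ 1#
  standard-𝟙 = trans (+-congˡ -0≈0) (+-identityʳ 1#)

  standard-⊙ : ∀ x y → proj₁ (MVAlgebra._⊙_ standard x y) ≈ 0# ⊔ (proj₁ x + proj₁ y - 1#)
  standard-⊙ (x , _) (y , _) with total 1# ((1# - x) + (1# - y))
  ... | inj₁ 1≤2-x-y = trans (-‿inverseʳ 1#) (sym (x≥y⇒x⊔y≈x
    (≤-respˡ-≈ (solve 3 (λ o x y → ((x :+ y) :- (o :+ o)) :+ o := (x :+ y) :- o) refl 1# x y)
    (≤-respʳ-≈ (solve 3 (λ o x y → ((x :+ y) :- (o :+ o)) :+ ((o :- x) :+ (o :- y)) := con (+ 0))
                      refl 1# x y)
    (+-monoʳ-≤ ((x + y) - (1# + 1#)) 1≤2-x-y)))))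
  ... | inj₂ 2-x-y≤1 = trans
    (solve 3 (λ o x y → o :- ((o :- x) :+ (o :- y)) := (x :+ y) :- o) refl 1# x y)
    (sym (x≤y⇒x⊔y≈y
    (≤-respˡ-≈ (solve 3 (λ o x y → ((x :+ y) :- (o :+ o)) :+ ((o :- x) :+ (o :- y)) := con (+ 0))
                      refl 1# x y)
    (≤-respʳ-≈ (solve 3 (λ o x y → ((x :+ y) :- (o :+ o)) :+ o := (x :+ y) :- o) refl 1# x y)
    (+-monoʳ-≤ ((x + y) - (1# + 1#)) 2-x-y≤1)))))

  [0,1]^_ : ℕ → Setoid 0ℓ 0ℓ
  [0,1]^ n = VectorEquality.≋-setoid [0,1] n

  Point : ℕ → Set
  Point n = Vector 𝕀 n

  RealFunction : ℕ → Set
  RealFunction n = Func ([0,1]^ n) [0,1]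

  infixl 20 _at_
  _at_ : ∀ {n} → RealFunction n → Point n → Carrier
  f at x = proj₁ (Func.to f x)

  -- ε-δ continuity for the supremum metric on [0,1]ⁿ.
  Continuous : ∀ {n} → RealFunction n → Set
  Continuous {n} f =
    ∀ (x : Point n) ε → 0# < ε → ∃ λ δ → 0# < δ × (∀ (y : Point n) →
      (∀ i → ∣ proj₁ (x i) - proj₁ (y i) ∣ < δ) → ∣ f at x - f at y ∣ < ε)

  record IntegerAffine (n : ℕ) : Set where
    constructor affine
    field
      coefficients : Vector ℤ n
      constant     : ℤ

  ⟦_⟧ : ∀ {n} → IntegerAffine n → Point n → Carrier
  ⟦ affine a b ⟧ x = sum (λ i → fromℤ (a i) * proj₁ (x i)) + fromℤ b

  PiecewiseIntegerAffine : ∀ {n} → RealFunction n → Set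
  PiecewiseIntegerAffine {n} f =
    Σ (List (IntegerAffine n)) λ ps → ∀ x → Any (λ p → f at x ≈ ⟦ p ⟧ x) ps

  -- Continuity together with a finite list of integer affine functions, one
  -- of which f agrees with at each point, is piecewise linearity with
  -- finitely many integer pieces.
  record McNaughton (n : ℕ) : Set where
    field
      function   : RealFunction n
      continuous : Continuous function
      piecewise  : PiecewiseIntegerAffine function

    open Func function public using (to; cong)

  ⟦_⟧-cong : ∀ {n} (p : IntegerAffine n) {x y} → (∀ i → proj₁ (x i) ≈ proj₁ (y i)) →
             ⟦ p ⟧ x ≈ ⟦ p ⟧ y
  ⟦ affine a b ⟧-cong x≈y = +-congʳ (sum-cong-≋ (λ i → *-congˡ (x≈y i)))

  infixl 6 _+ₐ_
  _+ₐ_ : ∀ {n} → IntegerAffine n → IntegerAffine n → IntegerAffine n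
  affine a b +ₐ affine a′ b′ = affine (λ i → a i ℤ.+ a′ i) (b ℤ.+ b′)

  1-ₐ_ : ∀ {n} → IntegerAffine n → IntegerAffine n
  1-ₐ affine a b = affine (λ i → ℤ.- a i) (ℤ.1ℤ ℤ.- b)

  constantₐ : ∀ {n} → ℤ → IntegerAffine n
  constantₐ b = affine (λ _ → ℤ.0ℤ) b

  ⟦+ₐ⟧ : ∀ {n} (p q : IntegerAffine n) x → ⟦ p +ₐ q ⟧ x ≈ ⟦ p ⟧ x + ⟦ q ⟧ x
  ⟦+ₐ⟧ (affine a b) (affine a′ b′) x = trans
    (+-cong
      (trans
        (sum-cong-≋ (λ i → trans (*-congʳ (fromℤ-homo-+ (a i) (a′ i))) (distribʳ _ _ _)))
        (∑-distrib-+ (λ i → fromℤ (a i) * proj₁ (x i)) (λ i → fromℤ (a′ i) * proj₁ (x i))))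
      (fromℤ-homo-+ b b′))
    (solve 4 (λ s t b c → (s :+ t) :+ (b :+ c) := (s :+ b) :+ (t :+ c)) refl _ _ _ _)

  sum-neg : ∀ {n} (t : Vector Carrier n) → sum (λ i → - t i) ≈ - sum t
  sum-neg {zero}  t = sym -0≈0
  sum-neg {suc n} t = trans (+-congˡ (sum-neg (λ i → t (Fin.suc i))))
    (solve 2 (λ a b → (:- a) :+ (:- b) := :- (a :+ b)) refl _ _)

  ⟦1-ₐ⟧ : ∀ {n} (p : IntegerAffine n) x → ⟦ 1-ₐ p ⟧ x ≈ 1# - ⟦ p ⟧ x
  ⟦1-ₐ⟧ (affine a b) x = trans
    (+-cong
      (trans (sum-cong-≋ (λ i → trans (*-congʳ (fromℤ-homo-neg (a i)))
                                      (solve 2 (λ a x → (:- a) :* x := :- (a :* x)) refl _ _)))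
             (sum-neg (λ i → fromℤ (a i) * proj₁ (x i))))
      (trans (fromℤ-homo-+ ℤ.1ℤ (ℤ.- b)) (+-cong (+-identityʳ 1#) (fromℤ-homo-neg b))))
    (solve 3 (λ s o b → (:- s) :+ (o :+ (:- b)) := o :+ (:- (s :+ b))) refl _ _ _)

  ⟦constantₐ⟧ : ∀ {n} b (x : Point n) → ⟦ constantₐ b ⟧ x ≈ fromℤ b
  ⟦constantₐ⟧ {n} b x = trans
    (+-congʳ (trans (sum-cong-≋ {n} (λ i → zeroˡ (proj₁ (x i)))) (sum-replicate-zero n)))
    (+-identityˡ _)

  private
    module S = MVAlgebra standard

  zeroF : ∀ {n} → McNaughton n
  zeroF = record
    { function   = record { to = λ _ → S.𝟘 ; cong = λ _ → refl }
    ; continuous = λ x ε 0<ε → ε , 0<ε , λ _ _ →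
        x<y+ε∧y<x+ε⇒∣x-y∣<ε (x<x+y 0<ε) (x<x+y 0<ε)
    ; piecewise  = constantₐ ℤ.0ℤ ∷ [] , λ x → here (sym (⟦constantₐ⟧ ℤ.0ℤ x))
    }

  negF : ∀ {n} → McNaughton n → McNaughton n
  negF f = record
    { function   = record { to = λ x → S.¬ to x ; cong = λ x≈y → S.¬-cong {to _} {to _} (cong x≈y) }
    ; continuous = λ x ε 0<ε → let δ , 0<δ , close = continuous x ε 0<ε in
        δ , 0<δ , λ y y∼x →
          x<y+ε∧y<x+ε⇒∣x-y∣<ε (flipped (∣x-y∣<ε⇒y<x+ε (close y y∼x)))
                               (flipped (∣x-y∣<ε⇒x<y+ε (close y y∼x)))
    ; piecewise  = map 1-ₐ_ (proj₁ piecewise) , λ x →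
        map⁺ (Any.map (λ {p} eq → trans (+-congˡ (-‿cong eq)) (sym (⟦1-ₐ⟧ p x)))
                      (proj₂ piecewise x))
    }
    where
    open McNaughton f
    flipped : ∀ {u v ε} → u < v + ε → 1# - v < (1# - u) + ε
    flipped {u} {v} {ε} u<v+ε = <-resp-≈
      (solve 3 (λ o u v → ((o :+ (:- u)) :+ (:- v)) :+ u := o :+ (:- v)) refl 1# u v)
      (solve 4 (λ o u v e → ((o :+ (:- u)) :+ (:- v)) :+ (v :+ e) := (o :+ (:- u)) :+ e)
             refl 1# u v ε)
      (+-monoʳ-< ((1# - u) - v) u<v+ε)

  plusF : ∀ {n} → McNaughton n → McNaughton n → McNaughton n
  plusF f g = record
    { function   = record
      { to   = λ x → F.to x S.⊕ G.to x
      ; cong = λ x≈y → ⊓-cong refl (+-cong (F.cong x≈y) (G.cong x≈y))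
      }
    ; continuous = λ x ε 0<ε →
        let η , 0<η , η+η≈ε = half 0<ε
            δ₁ , 0<δ₁ , closeF = F.continuous x η 0<η
            δ₂ , 0<δ₂ , closeG = G.continuous x η 0<η
        in δ₁ ⊓ δ₂ , ⊓-pos 0<δ₁ 0<δ₂ , λ y y∼x →
          let cF = closeF y (λ i → <-≤-trans (y∼x i) (x⊓y≤x _ _))
              cG = closeG y (λ i → <-≤-trans (y∼x i) (x⊓y≤y _ _))
          in x<y+ε∧y<x+ε⇒∣x-y∣<ε
               (truncated 0<ε (added η+η≈ε (∣x-y∣<ε⇒x<y+ε cF) (∣x-y∣<ε⇒x<y+ε cG)))
               (truncated 0<ε (added η+η≈ε (∣x-y∣<ε⇒y<x+ε cF) (∣x-y∣<ε⇒y<x+ε cG)))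
    ; piecewise  =
        constantₐ ℤ.1ℤ ∷ cartesianProductWith _+ₐ_ (proj₁ F.piecewise) (proj₁ G.piecewise)
      , pieces
    }
    where
    module F = McNaughton f
    module G = McNaughton g

    added : ∀ {a b c d η ε} → η + η ≈ ε → a < b + η → c < d + η → a + c < (b + d) + ε
    added {b = b} {d = d} {η = η} η+η≈ε p q = <-resp-≈ refl
      (trans (solve 3 (λ b d e → (b :+ e) :+ (d :+ e) := (b :+ d) :+ (e :+ e)) refl b d η)
             (+-congˡ η+η≈ε))
      (+-mono-< p q)

    truncated : ∀ {u v ε} → 0# < ε → u < v + ε → 1# ⊓ u < (1# ⊓ v) + ε
    truncated {u} {v} 0<ε u<v+ε with total 1# v
    ... | inj₁ _ = ≤-<-trans (x⊓y≤x 1# u) (x<x+y 0<ε)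
    ... | inj₂ _ = ≤-<-trans (x⊓y≤y 1# u) u<v+ε

    pieces : ∀ x → Any (λ p → 1# ⊓ (F.function at x + G.function at x) ≈ ⟦ p ⟧ x) _
    pieces x with total 1# (F.function at x + G.function at x)
    ... | inj₁ _ = here (sym (trans (⟦constantₐ⟧ ℤ.1ℤ x) (+-identityʳ 1#)))
    ... | inj₂ _ = there (cartesianProductWith⁺ _+ₐ_
      (λ {p} {q} f≈p g≈q → trans (+-cong f≈p g≈q) (sym (⟦+ₐ⟧ p q x)))
      (F.piecewise .proj₂ x) (G.piecewise .proj₂ x))

  -- The free n-generated MV-algebra, represented (McNaughton's theorem)
  -- by the McNaughton functions with pointwise operations.
  𝐅 : ℕ → MVAlgebra 0ℓ 0ℓ
  𝐅 n = record
    { Carrier             = McNaughton n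
    ; _≈_                 = λ f g → ∀ x → to f x S.≈ to g x
    ; _⊕_                 = plusF
    ; ¬_                  = negF
    ; 𝟘                   = zeroF
    ; isCommutativeMonoid = record
      { isMonoid = record
        { isSemigroup = record
          { isMagma = record
            { isEquivalence = record
              { refl  = λ x → refl
              ; sym   = λ f≈g x → sym (f≈g x)
              ; trans = λ f≈g g≈h x → trans (f≈g x) (g≈h x)
              }
            ; ∙-cong        = λ f≈g h≈k x → ⊓-cong refl (+-cong (f≈g x) (h≈k x))
            }
          ; assoc = λ f g h x → M.assoc (to f x) (to g x) (to h x)
          }
        ; identity = (λ f x → M.identityˡ (to f x)) , (λ f x → M.identityʳ (to f x))
        }
      ; comm = λ f g x → M.comm (to f x) (to g x)
      }
    ; ¬-cong       = λ f≈g x → +-congˡ (-‿cong (f≈g x))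
    ; ¬-involutive = λ f x → S.¬-involutive (to f x)
    ; ⊕-zeroʳ      = λ f x → S.⊕-zeroʳ (to f x)
    ; łukasiewicz  = λ f g x → S.łukasiewicz (to f x) (to g x)
    }
    where
    open McNaughton using (to)
    module M = IsCommutativeMonoid S.isCommutativeMonoid

  record State {c ℓ} (A : MVAlgebra c ℓ) : Set (c L.⊔ ℓ) where
    private module A = MVAlgebra A
    field
      function : Func A.setoid [0,1]
    value : A.Carrier → Carrier
    value a = proj₁ (Func.to function a)
    field
      normalised : value A.𝟙 ≈ 1#
      additive   : ∀ a b → a A.⊙ b A.≈ A.𝟘 → value (a A.⊕ b) ≈ value a + value b

  Faithful : ∀ {c ℓ} {A : MVAlgebra c ℓ} → State A → Set (c L.⊔ ℓ)
  Faithful {A = A} s = ∀ a → a ≉ᴬ 𝟘 → State.value s a ≉ 0#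
    where open MVAlgebra A using (𝟘) renaming (_≉_ to _≉ᴬ_)

  -- The finite set Φ = {f₁,…,f_k} is an enumeration f of its elements,
  -- repetitions allowed; a book is a map on the set, so it must take
  -- equal values at indices naming the same element.
  module _ {n k : ℕ} (f : Vector (McNaughton n) k) where

    Book : Set
    Book = Func (On.setoid (MVAlgebra.setoid (𝐅 n)) f) [0,1]

    balance : Book → Vector Carrier k → Point n → Carrier
    balance β σ x =
      sum (λ i → σ i * (proj₁ (Func.to β i) - McNaughton.function (f i) at x))

    StrictlyCoherent : Book → Set
    StrictlyCoherent β = ∀ (σ : Vector Carrier k) →
      (∃ λ x → balance β σ x < 0#) → (∃ λ x′ → 0# < balance β σ x′)

    Extends : State (𝐅 n) → Book → Set
    Extends s β = ∀ i → State.value s (f i) ≈ proj₁ (Func.to β i)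

{-# OPTIONS --safe #-}
module Submission where

-- Call an additive map μ : 𝐅 n → [0,∞) a measure; evaluations at points are
-- measures. Since sums of McNaughton functions can be subtracted as in a
-- Riesz space, a real combination Σ σᵢ hᵢ that is nonnegative at all points has
-- nonnegative value Σ σᵢ μ(hᵢ) for every measure μ (approximate σ by
-- integers). If moreover the combination is positive somewhere, a nonzero
-- McNaughton function lies below a multiple of it, so the value is positive
-- when μ is faithful; this gives (2) ⇒ (1).
--
-- For (1) ⇒ (2), strict coherence says that no hyperplane properly separates
-- the origin from the gain vectors β - f(x). By Fourier–Motzkin elimination
-- (no compactness is needed) the cone they span is then a linear subspace.
-- It contains μ(f) - μ(1) β for any measure μ, in particular for a faithful one
-- charging a countable dense set of points. Adding to μ the point
-- masses that express this vector as a conic combination of gains and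
-- normalising yields a faithful state extending β.

open import Defs
open import Algebra.Structures using (IsCommutativeMonoid)
import Algebra.Properties.CommutativeMonoid.Sum as MonoidSum
import Algebra.Properties.CommutativeSemigroup as CommutativeSemigroupProperties
import Algebra.Properties.Ring as RingProperties
import Algebra.Properties.Semiring.Sum as SemiringSum
open import Axiom.ExcludedMiddle using (ExcludedMiddle)
import Data.Fin.Base as Fin
open import Data.Integer.Base using (+_)
open import Data.List.Base using (List; []; _∷_; _++_; replicate)
open import Data.Nat.Base as ℕ using (ℕ; zero; suc)
import Data.Nat.Properties as ℕ
open import Data.Product.Base using (Σ; _×_; ∃; _,_; proj₁; proj₂)
open import Data.Sum.Base using (_⊎_; inj₁; inj₂)
open import Data.Vec.Functional as Vector using (Vector; tail)
open import Function.Base using (case_of_; _∘_)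
open import Function.Bundles using (_⇔_; mk⇔; Func)
import Level as L
open L using (0ℓ)
open import Relation.Binary.Bundles using (TotalOrder)
import Relation.Binary.PropositionalEquality.Core as ≡
import Relation.Binary.Reasoning.PartialOrder as PartialOrderReasoning
open import Relation.Nullary.Decidable.Core using (Dec; yes; no)
open import Relation.Nullary.Negation.Core using (¬_; contradiction)

-- Order and Archimedean properties of the reals, and scalar products.

module CompleteOrderedFieldProperties
  (em : ExcludedMiddle 0ℓ) (ℝ : CompleteOrderedField) where

  open CompleteOrderedField ℝ
  open OrderedFieldProperties ℝ
  open MonoidSum +-commutativeMonoid using (sum-cong-≋; ∑-distrib-+)
  open SemiringSum semiring using (*-distribˡ-sum)
  module ≤-Reasoning = PartialOrderReasoning (TotalOrder.poset totalOrder)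
  open ≤-Reasoning

  <⇒≱ : ∀ {x y} → x < y → ¬ y ≤ x
  <⇒≱ (x≤y , x≉y) y≤x = x≉y (antisym x≤y y≤x)

  ≤-or-> : ∀ x y → x ≤ y ⊎ y < x
  ≤-or-> x y with em {x ≤ y} | total x y
  ... | yes x≤y | _        = inj₁ x≤y
  ... | no  x≰y | inj₁ x≤y = contradiction x≤y x≰y
  ... | no  x≰y | inj₂ y≤x = inj₂ (y≤x , λ y≈x → x≰y (≤-reflexive (sym y≈x)))

  x≤y⇒0≤y-x : ∀ {x y} → x ≤ y → 0# ≤ y - x
  x≤y⇒0≤y-x {x} x≤y = ≤-respˡ-≈ (-‿inverseʳ x) (+-monoˡ-≤ (- x) x≤y)

  0≤y-x⇒x≤y : ∀ {x y} → 0# ≤ y - x → x ≤ y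
  0≤y-x⇒x≤y {x} {y} 0≤y-x = ≤-respˡ-≈ (+-identityʳ x)
    (≤-respʳ-≈ (solve 2 (λ x y → x :+ (y :- x) := y) refl x y) (+-monoʳ-≤ x 0≤y-x))

  x≤0⇒0≤-x : ∀ {x} → x ≤ 0# → 0# ≤ - x
  x≤0⇒0≤-x x≤0 = ≤-respˡ-≈ -0≈0 (-‿anti-≤ x≤0)

  0≤-x⇒x≤0 : ∀ {x} → 0# ≤ - x → x ≤ 0#
  0≤-x⇒x≤0 0≤-x = ≤-respˡ-≈ (-‿involutive _) (≤-respʳ-≈ -0≈0 (-‿anti-≤ 0≤-x))

  0<-x⇒x<0 : ∀ {x} → 0# < - x → x < 0#
  0<-x⇒x<0 {x} 0<-x = <-resp-≈ (+-identityʳ x) (-‿inverseʳ x) (+-monoʳ-< x 0<-x)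

  x<0⇒0<-x : ∀ {x} → x < 0# → 0# < - x
  x<0⇒0<-x {x} x<0 = <-resp-≈ (-‿inverseˡ x) (+-identityʳ (- x)) (+-monoʳ-< (- x) x<0)

  +-nonneg : ∀ {x y} → 0# ≤ x → 0# ≤ y → 0# ≤ x + y
  +-nonneg 0≤x 0≤y = ≤-trans 0≤x (x≤x+y 0≤y)

  x+y≤z⇒x≤z-y : ∀ {x y z} → x + y ≤ z → x ≤ z - y
  x+y≤z⇒x≤z-y {x} {y} x+y≤z =
    ≤-respˡ-≈ (solve 2 (λ x y → (x :+ y) :- y := x) refl x y) (+-monoˡ-≤ (- y) x+y≤z)

  x≤z-y⇒x+y≤z : ∀ {x y z} → x ≤ z - y → x + y ≤ z
  x≤z-y⇒x+y≤z {y = y} {z} x≤z-y =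
    ≤-respʳ-≈ (solve 2 (λ y z → (z :- y) :+ y := z) refl y z) (+-monoˡ-≤ y x≤z-y)

  x+y≈0⇒x≈0∧y≈0 : ∀ {x y} → 0# ≤ x → 0# ≤ y → x + y ≈ 0# → x ≈ 0# × y ≈ 0#
  x+y≈0⇒x≈0∧y≈0 0≤x 0≤y x+y≈0 =
      antisym (≤-respʳ-≈ x+y≈0 (x≤x+y 0≤y)) 0≤x
    , antisym (≤-respʳ-≈ (trans (+-comm _ _) x+y≈0) (x≤x+y 0≤x)) 0≤y

  x+y≤x⇒y≤0 : ∀ {x y} → x + y ≤ x → y ≤ 0#
  x+y≤x⇒y≤0 {x} {y} x+y≤x = ≤-respˡ-≈ (solve 2 (λ x y → (x :+ y) :- x := y) refl x y)
    (≤-respʳ-≈ (-‿inverseʳ x) (+-monoˡ-≤ (- x) x+y≤x))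

  *-monoʳ-≤-nonneg : ∀ {c x y} → 0# ≤ c → x ≤ y → c * x ≤ c * y
  *-monoʳ-≤-nonneg {c} {x} {y} 0≤c x≤y = 0≤y-x⇒x≤y (≤-respʳ-≈
    (solve 3 (λ c x y → c :* (y :- x) := c :* y :- c :* x) refl c x y)
    (*-nonneg 0≤c (x≤y⇒0≤y-x x≤y)))

  *-monoˡ-≤-nonneg : ∀ {c x y} → 0# ≤ c → x ≤ y → x * c ≤ y * c
  *-monoˡ-≤-nonneg {c} {x} {y} 0≤c x≤y =
    ≤-respˡ-≈ (*-comm c x) (≤-respʳ-≈ (*-comm c y) (*-monoʳ-≤-nonneg 0≤c x≤y))

  *-monoˡ-≤-nonpos : ∀ {c x y} → c ≤ 0# → x ≤ y → y * c ≤ x * c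
  *-monoˡ-≤-nonpos {c} {x} {y} c≤0 x≤y = ≤-respˡ-≈ (neg y) (≤-respʳ-≈ (neg x)
    (-‿anti-≤ (*-monoʳ-≤-nonneg (x≤0⇒0≤-x c≤0) x≤y)))
    where
    neg : ∀ z → - (- c * z) ≈ z * c
    neg z = solve 2 (λ c z → :- ((:- c) :* z) := z :* c) refl c z

  *-cancel-zero : ∀ {x y} → x ≉ 0# → x * y ≈ 0# → y ≈ 0#
  *-cancel-zero {x} {y} x≉0 xy≈0 with inverse x x≉0
  ... | z , xz≈1 = begin-equality
    y            ≈⟨ *-identityʳ y ⟨
    y * 1#       ≈⟨ *-congˡ xz≈1 ⟨
    y * (x * z)  ≈⟨ solve 3 (λ x y z → y :* (x :* z) := z :* (x :* y)) refl x y z ⟩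
    z * (x * y)  ≈⟨ *-congˡ xy≈0 ⟩
    z * 0#       ≈⟨ zeroʳ z ⟩
    0#           ∎

  *-cancelˡ-≉0 : ∀ {x y z} → x ≉ 0# → x * y ≈ x * z → y ≈ z
  *-cancelˡ-≉0 {x} {y} {z} x≉0 xy≈xz = begin-equality
    y            ≈⟨ solve 2 (λ y z → y := (y :- z) :+ z) refl y z ⟩
    (y - z) + z  ≈⟨ +-congʳ (*-cancel-zero x≉0 x[y-z]≈0) ⟩
    0# + z       ≈⟨ +-identityˡ z ⟩
    z            ∎
    where
    x[y-z]≈0 : x * (y - z) ≈ 0#
    x[y-z]≈0 = trans (solve 3 (λ x y z → x :* (y :- z) := x :* y :- x :* z) refl x y z)
      (trans (+-congʳ xy≈xz) (-‿inverseʳ (x * z)))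

  pos⇒≉0 : ∀ {x} → 0# < x → x ≉ 0#
  pos⇒≉0 (_ , 0≉x) x≈0 = 0≉x (sym x≈0)

  *-pos : ∀ {x y} → 0# < x → 0# < y → 0# < x * y
  *-pos 0<x 0<y =
    *-nonneg (proj₁ 0<x) (proj₁ 0<y) ,
    λ 0≈xy → pos⇒≉0 0<y (*-cancel-zero (pos⇒≉0 0<x) (sym 0≈xy))

  *-cancel-nonneg : ∀ {x y} → 0# < x → 0# ≤ x * y → 0# ≤ y
  *-cancel-nonneg {x} {y} 0<x 0≤xy with ≤-or-> 0# y
  ... | inj₁ 0≤y = 0≤y
  ... | inj₂ y<0 = contradiction 0≤xy (<⇒≱ (0<-x⇒x<0
    (<-resp-≈ refl (solve 2 (λ x y → x :* (:- y) := :- (x :* y)) refl x y)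
      (*-pos 0<x (x<0⇒0<-x y<0)))))

  0<1 : 0# < 1#
  0<1 = 0≤1 , 0#≉1#

  inverse-pos : ∀ {x} → 0# < x → ∃ λ y → 0# < y × x * y ≈ 1#
  inverse-pos {x} 0<x with inverse x (pos⇒≉0 0<x)
  ... | y , xy≈1 = y , (*-cancel-nonneg 0<x (≤-respʳ-≈ (sym xy≈1) 0≤1) , 0≉y) , xy≈1
    where
    0≉y : 0# ≉ y
    0≉y 0≈y = 0#≉1# (trans (sym (zeroʳ x)) (trans (*-congˡ 0≈y) xy≈1))

  ·1-nonneg : ∀ m → 0# ≤ m · 1#
  ·1-nonneg zero    = ≤-refl
  ·1-nonneg (suc m) = +-nonneg 0≤1 (·1-nonneg m)

  -- If no natural number reached `x`, the naturals would have a supremum `s`; but `suc m · 1# ≤ s`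
  -- for all `m` makes `s - 1#` an upper bound too.
  archimedean : ∀ x → ∃ λ m → x ≤ m · 1#
  archimedean x with em {∃ λ m → x ≤ m · 1#}
  ... | yes bounded = bounded
  ... | no  unbounded = contradiction s≤s-1 (<⇒≱ s-1<s)
    where
    IsNatural : Carrier → Set
    IsNatural r = ∃ λ m → r ≈ m · 1#

    m≤x : ∀ m → m · 1# ≤ x
    m≤x m with total (m · 1#) x
    ... | inj₁ m≤x = m≤x
    ... | inj₂ x≤m = contradiction (m , x≤m) unbounded

    least = supremum IsNatural (0# , 0 , refl)
      (x , λ { (m , r≈m) → ≤-respˡ-≈ (sym r≈m) (m≤x m) })
    s = proj₁ least

    s≤s-1 : s ≤ s - 1#
    s≤s-1 = proj₂ (proj₂ least) λ { {r} (m , r≈m) → begin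
      r                  ≈⟨ r≈m ⟩
      m · 1#             ≈⟨ solve 2 (λ o m → m := (o :+ m) :- o) refl 1# (m · 1#) ⟩
      suc m · 1# - 1#    ≤⟨ +-monoˡ-≤ (- 1#) (proj₁ (proj₂ least) (suc m , refl)) ⟩
      s - 1#             ∎ }

    s-1<s : s - 1# < s
    s-1<s = <-resp-≈ refl (solve 2 (λ o s → (s :- o) :+ o := s) refl 1# s) (x<x+y 0<1)

  archimedean-pos : ∀ {ε} → 0# < ε → ∀ x → ∃ λ m → x < m · 1# * ε
  archimedean-pos {ε} 0<ε x with inverse-pos 0<ε
  ... | y , 0<y , εy≈1 with archimedean (x * y)
  ... | m , xy≤m = suc m , (begin-strict
    x                    ≈⟨ *-identityʳ x ⟨
    x * 1#               ≈⟨ *-congˡ εy≈1 ⟨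
    x * (ε * y)          ≈⟨ solve 3 (λ x e y → x :* (e :* y) := e :* (x :* y)) refl x ε y ⟩
    ε * (x * y)          ≤⟨ *-monoʳ-≤-nonneg (proj₁ 0<ε) xy≤m ⟩
    ε * (m · 1#)         <⟨ x<x+y 0<ε ⟩
    ε * (m · 1#) + ε     ≈⟨ +-congˡ (*-identityʳ ε) ⟨
    ε * (m · 1#) + ε * 1# ≈⟨ solve 3 (λ e m o → e :* m :+ e :* o := (o :+ m) :* e)
                                 refl ε (m · 1#) 1# ⟩
    suc m · 1# * ε       ∎)

  -- Search downwards from an Archimedean bound; `0# ≤ x` settles the case where the search reaches
  -- zero.
  floor : ∀ x → 0# ≤ x → ∃ λ m → m · 1# ≤ x × x < suc m · 1#
  floor x 0≤x = descend (proj₁ bound)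
    (≤-<-trans (proj₂ bound) (<-resp-≈ refl (+-comm _ _) (x<x+y 0<1)))
    where
    bound = archimedean x

    descend : ∀ m → x < suc m · 1# → ∃ λ m → m · 1# ≤ x × x < suc m · 1#
    descend zero    x<1   = 0 , 0≤x , x<1
    descend (suc m) x<2+m with ≤-or-> (suc m · 1#) x
    ... | inj₁ 1+m≤x = suc m , 1+m≤x , x<2+m
    ... | inj₂ x<1+m = descend m x<1+m

  -- The integer is kept as a difference of naturals because `p` and `q` later become multiplicities
  -- in lists. Adding some natural `q ≥ - x` reduces the claim to `floor`.
  integer-part : ∀ x → ∃ λ p → ∃ λ q →
                 p · 1# - q · 1# ≤ x × x ≤ (p · 1# - q · 1#) + 1#
  integer-part x with archimedean (- x)
  ... | q , -x≤q with floor (x + q · 1#) (≤-respˡ-≈ (-‿inverseʳ x) (+-monoʳ-≤ x -x≤q))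
  ... | p , p≤x+q , x+q<1+p = p , q , lower , upper
    where
    lower = ≤-respʳ-≈ (solve 2 (λ x q → (x :+ q) :- q := x) refl x (q · 1#))
      (+-monoˡ-≤ (- (q · 1#)) p≤x+q)
    upper = ≤-respˡ-≈ (solve 2 (λ x q → (x :+ q) :- q := x) refl x (q · 1#))
      (≤-respʳ-≈ (solve 3 (λ o p q → (o :+ p) :- q := (p :- q) :+ o) refl 1# (p · 1#) (q · 1#))
        (+-monoˡ-≤ (- (q · 1#)) (proj₁ x+q<1+p)))

  infixl 7 _∙_
  _∙_ : ∀ {k} → Vector Carrier k → Vector Carrier k → Carrier
  σ ∙ v = sum (λ i → σ i * v i)

  ∙-congʳ : ∀ {k} (σ : Vector Carrier k) {v w} → (∀ i → v i ≈ w i) → σ ∙ v ≈ σ ∙ w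
  ∙-congʳ {k} σ v≈w = sum-cong-≋ {k} (λ i → *-congˡ (v≈w i))

  ∙-distribˡ-+ : ∀ {k} (σ v w : Vector Carrier k) → σ ∙ (λ i → v i + w i) ≈ σ ∙ v + σ ∙ w
  ∙-distribˡ-+ {k} σ v w = trans (sum-cong-≋ {k} (λ i → distribˡ (σ i) (v i) (w i)))
    (∑-distrib-+ (λ i → σ i * v i) (λ i → σ i * w i))

  ∙-*-homoˡ : ∀ {k} c (σ v : Vector Carrier k) → (λ i → c * σ i) ∙ v ≈ c * (σ ∙ v)
  ∙-*-homoˡ {k} c σ v = trans (sum-cong-≋ {k} (λ i → *-assoc c (σ i) (v i)))
    (sym (*-distribˡ-sum c (λ i → σ i * v i)))

  ∙-*-homoʳ : ∀ {k} c (σ v : Vector Carrier k) → σ ∙ (λ i → c * v i) ≈ c * (σ ∙ v)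
  ∙-*-homoʳ {k} c σ v = trans
    (sum-cong-≋ {k} (λ i → solve 3 (λ c s v → s :* (c :* v) := (c :* s) :* v) refl c (σ i) (v i)))
    (∙-*-homoˡ c σ v)

  ∙-neg-homoˡ : ∀ {k} (σ v : Vector Carrier k) → (λ i → - σ i) ∙ v ≈ - (σ ∙ v)
  ∙-neg-homoˡ {zero}  σ v = sym -0≈0
  ∙-neg-homoˡ {suc k} σ v = trans (+-congˡ (∙-neg-homoˡ (tail σ) (tail v)))
    (solve 3 (λ s v r → (:- s) :* v :+ (:- r) := :- (s :* v :+ r)) refl _ _ _)

  ∙-neg-homoʳ : ∀ {k} (σ v : Vector Carrier k) → σ ∙ (λ i → - v i) ≈ - (σ ∙ v)
  ∙-neg-homoʳ σ v = trans
    (sum-cong-≋ (λ i → solve 2 (λ s v → s :* (:- v) := (:- s) :* v) refl (σ i) (v i)))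
    (∙-neg-homoˡ σ v)

  ∙-zeroˡ : ∀ {k} (v : Vector Carrier k) → (λ _ → 0#) ∙ v ≈ 0#
  ∙-zeroˡ {zero}  v = refl
  ∙-zeroˡ {suc k} v = trans (+-cong (zeroˡ _) (∙-zeroˡ (tail v))) (+-identityˡ 0#)

-- Convex cones and Fourier-Motzkin elimination.

module ConvexCones (em : ExcludedMiddle 0ℓ) (ℝ : CompleteOrderedField) where

  open CompleteOrderedField ℝ
  open OrderedFieldProperties ℝ
  open CompleteOrderedFieldProperties em ℝ
  open ≤-Reasoning

  -- A conic combination is a list of weighted generators, so that `correct` can consume it one
  -- generator at a time. Equations are pointwise, as vectors are functions.
  data Cone {k} {X : Set} (v : X → Vector Carrier k) : Vector Carrier k → Set where
    vertex : ∀ {w} → (∀ i → w i ≈ 0#) → Cone v w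
    step   : ∀ {w w′} c x → 0# ≤ c → (∀ i → w i ≈ c * v x i + w′ i) → Cone v w′ → Cone v w

  module _ {k} {X : Set} {v : X → Vector Carrier k} where

    Cone-resp-≈ : ∀ {w u} → (∀ i → u i ≈ w i) → Cone v w → Cone v u
    Cone-resp-≈ u≈w (vertex w≈0)           = vertex (λ i → trans (u≈w i) (w≈0 i))
    Cone-resp-≈ u≈w (step c x 0≤c w≈ rest) = step c x 0≤c (λ i → trans (u≈w i) (w≈ i)) rest

    Cone-+ : ∀ {w u} → Cone v w → Cone v u → Cone v (λ i → w i + u i)
    Cone-+ (vertex w≈0) C = Cone-resp-≈ (λ i → trans (+-congʳ (w≈0 i)) (+-identityˡ _)) C
    Cone-+ (step c x 0≤c w≈ rest) C =
      step c x 0≤c (λ i → trans (+-congʳ (w≈ i)) (+-assoc _ _ _)) (Cone-+ rest C)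

    Cone-scale : ∀ {w} c → 0# ≤ c → Cone v w → Cone v (λ i → c * w i)
    Cone-scale c 0≤c (vertex w≈0) = vertex (λ i → trans (*-congˡ (w≈0 i)) (zeroʳ c))
    Cone-scale c 0≤c (step d x 0≤d w≈ rest) = step (c * d) x (*-nonneg 0≤c 0≤d)
      (λ i → trans (*-congˡ (w≈ i))
        (solve 4 (λ c d v w → c :* (d :* v :+ w) := (c :* d) :* v :+ c :* w) refl _ _ _ _))
      (Cone-scale c 0≤c rest)

    Cone-bind : ∀ {Y : Set} {u : Y → Vector Carrier k} {w} →
                (∀ y → Cone v (u y)) → Cone u w → Cone v w
    Cone-bind gen (vertex w≈0) = vertex w≈0
    Cone-bind gen (step c y 0≤c w≈ rest) =
      Cone-resp-≈ w≈ (Cone-+ (Cone-scale c 0≤c (gen y)) (Cone-bind gen rest))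

  -- Undoes the dropping of a coordinate. The target `w` is fixed only up to pointwise equality,
  -- which lets the induction continue with head `0#`.
  Cone-untail : ∀ {k} {X : Set} {v : X → Vector Carrier (suc k)} {t w} →
    (∀ x → v x Fin.zero ≈ 0#) → w Fin.zero ≈ 0# → (∀ i → w (Fin.suc i) ≈ t i) →
    Cone (λ x → tail (v x)) t → Cone v w
  Cone-untail v₀≈0 w₀≈0 w≈t (vertex t≈0) = vertex λ
    { Fin.zero    → w₀≈0
    ; (Fin.suc i) → trans (w≈t i) (t≈0 i) }
  Cone-untail {v = v} v₀≈0 w₀≈0 w≈t (step {w′ = t′} c x 0≤c t≈ rest) =
    step {w′ = 0# Vector.∷ t′} c x 0≤c
      (λ { Fin.zero    → trans w₀≈0 (sym (trans (+-identityʳ _)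
                           (trans (*-congˡ (v₀≈0 x)) (zeroʳ c))))
         ; (Fin.suc i) → trans (w≈t i) (t≈ i) })
      (Cone-untail v₀≈0 refl (λ _ → refl) rest)

  -- No hyperplane through the origin properly separates w from the cone of v.
  Unseparated : ∀ {k} {X : Set} → (X → Vector Carrier k) → Vector Carrier k → Set
  Unseparated v w = ∀ σ → (∀ x → 0# ≤ σ ∙ v x) → (∀ x → σ ∙ v x ≈ 0#) × σ ∙ w ≈ 0#

  -- Elimination of the first coordinate.

  module FourierMotzkin
    {k} {X : Set} (v : X → Vector Carrier (suc k)) (w : Vector Carrier (suc k))
    (unseparated : Unseparated v w)
    where

    v₀ : X → Carrier
    v₀ x = v x Fin.zero

    -- The inequalities are weak so that a generator with first coordinate zero can be paired with
    -- `x⁺`; its eliminant is then a positive multiple of itself.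
    Pair : Set
    Pair = Σ X λ x → Σ X λ y → 0# ≤ v₀ x × v₀ y ≤ 0#

    eliminant : Pair → Vector Carrier (suc k)
    eliminant (x , y , _) i = v₀ x * v y i + (- v₀ y) * v x i

    eliminant₀≈0 : ∀ z → eliminant z Fin.zero ≈ 0#
    eliminant₀≈0 (x , y , _) = trans
      (solve 2 (λ a b → a :* b :+ (:- b) :* a := a :- a) refl (v₀ x) (v₀ y)) (-‿inverseʳ (v₀ x))

    eliminant∈Cone : ∀ z → Cone v (eliminant z)
    eliminant∈Cone (x , y , 0≤vx , vy≤0) =
      step (v₀ x) y 0≤vx (λ _ → refl)
      (step (- v₀ y) x (x≤0⇒0≤-x vy≤0) (λ _ → sym (+-identityʳ _))
      (vertex (λ _ → refl)))

    -- Stated for any vectors `t` indexed by the generators, to cover both the generators and their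
    -- tails.
    ∙-eliminant : ∀ {n} (σ : Vector Carrier n) (t : X → Vector Carrier n) (z : Pair) →
      σ ∙ (λ i → v₀ (proj₁ z) * t (proj₁ (proj₂ z)) i + (- v₀ (proj₁ (proj₂ z))) * t (proj₁ z) i)
        ≈ v₀ (proj₁ z) * (σ ∙ t (proj₁ (proj₂ z))) + (- v₀ (proj₁ (proj₂ z))) * (σ ∙ t (proj₁ z))
    ∙-eliminant σ t (x , y , _) = trans
      (∙-distribˡ-+ σ (λ i → v₀ x * t y i) (λ i → (- v₀ y) * t x i))
      (+-cong (∙-*-homoʳ (v₀ x) σ (t y)) (∙-*-homoʳ (- v₀ y) σ (t x)))

    module Extend (x⁺ : X) (0<v⁺ : 0# < v₀ x⁺) (x⁻ : X) (v⁻<0 : v₀ x⁻ < 0#) where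

      module _ (σ : Vector Carrier k) (nonneg : ∀ z → 0# ≤ σ ∙ tail (eliminant z)) where

        s : X → Carrier
        s x = σ ∙ tail (v x)

        pairwise : ∀ x y → 0# ≤ v₀ x → v₀ y ≤ 0# → 0# ≤ v₀ x * s y + (- v₀ y) * s x
        pairwise x y 0≤vx vy≤0 = ≤-respʳ-≈
          (∙-eliminant σ (λ x → tail (v x)) (x , y , 0≤vx , vy≤0)) (nonneg (x , y , 0≤vx , vy≤0))

        -- For `0# < v₀ x`, the requirement `0# ≤ σ₀ * v₀ x + s x` says that `σ₀` is at least the
        -- root `r`. Generators with negative first coordinate give upper constraints in the same
        -- way.
        LowerConstraint : Carrier → Set
        LowerConstraint r = ∃ λ x → 0# < v₀ x × r * v₀ x + s x ≈ 0#

        root : ∀ x → v₀ x ≉ 0# → ∃ λ r → r * v₀ x + s x ≈ 0#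
        root x vx≉0 with inverse (v₀ x) vx≉0
        ... | y , vxy≈1 = (- s x) * y , (begin-equality
          (- s x) * y * v₀ x + s x    ≈⟨ solve 3 (λ a b c → (:- a) :* b :* c :+ a
                                           := a :- a :* (c :* b)) refl (s x) y (v₀ x) ⟩
          s x - s x * (v₀ x * y)      ≈⟨ +-congˡ (-‿cong (trans (*-congˡ vxy≈1) (*-identityʳ _))) ⟩
          s x - s x                   ≈⟨ -‿inverseʳ (s x) ⟩
          0#                          ∎)

        -- Substituting the two roots turns the nonnegative value on the eliminant of `x` and `y`
        -- into a positive multiple of `u - r`.
        lower≤upper : ∀ y → v₀ y < 0# → ∀ u → u * v₀ y + s y ≈ 0# →
                      ∀ {r} → LowerConstraint r → r ≤ u
        lower≤upper y vy<0 u u-root {r} (x , 0<vx , r-root) =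
          0≤y-x⇒x≤y (*-cancel-nonneg (*-pos 0<vx (x<0⇒0<-x vy<0)) (begin
            0#                                 ≤⟨ pairwise x y (proj₁ 0<vx) (proj₁ vy<0) ⟩
            a * s y + (- b) * s x              ≈⟨ solve 6 (λ a b r u t s →
              a :* t :+ (:- b) :* s :=
              ((a :* (:- b)) :* (u :- r) :+ a :* (u :* b :+ t)) :+ (:- b) :* (r :* a :+ s))
              refl a b r u (s y) (s x) ⟩
            ((a * - b) * (u - r) + a * (u * b + s y)) + (- b) * (r * a + s x)
              ≈⟨ +-cong (+-congˡ (trans (*-congˡ u-root) (zeroʳ a)))
                        (trans (*-congˡ r-root) (zeroʳ (- b))) ⟩
            ((a * - b) * (u - r) + 0#) + 0#    ≈⟨ trans (+-identityʳ _) (+-identityʳ _) ⟩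
            (a * - b) * (u - r)                ∎))
          where
          a = v₀ x
          b = v₀ y

        module _ σ₀ (above : ∀ {r} → LowerConstraint r → r ≤ σ₀)
                 (below : ∀ {u} → (∀ {r} → LowerConstraint r → r ≤ u) → σ₀ ≤ u) where

          extended-nonneg : ∀ x → 0# ≤ (σ₀ Vector.∷ σ) ∙ v x
          extended-nonneg x = cases (≤-or-> (v₀ x) 0#) em
            where
            cases : v₀ x ≤ 0# ⊎ 0# < v₀ x → Dec (v₀ x ≈ 0#) → 0# ≤ σ₀ * v₀ x + s x
            cases (inj₂ 0<vx) _ = let r , r-root = root x (pos⇒≉0 0<vx) in
              ≤-respˡ-≈ r-root (+-monoˡ-≤ (s x)
                (*-monoˡ-≤-nonneg (proj₁ 0<vx) (above (x , 0<vx , r-root))))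
            cases (inj₁ vx≤0) (no vx≉0) = let u , u-root = root x vx≉0 in
              ≤-respˡ-≈ u-root (+-monoˡ-≤ (s x)
                (*-monoˡ-≤-nonpos vx≤0 (below (lower≤upper x (vx≤0 , vx≉0) u u-root))))
            -- Here `σ₀` has no influence; the eliminant of `x⁺` and `x` already gives `0# ≤ s x`.
            cases (inj₁ vx≤0) (yes vx≈0) = begin
              0#               ≤⟨ *-cancel-nonneg 0<v⁺ (begin
                0#                             ≤⟨ pairwise x⁺ x (proj₁ 0<v⁺) vx≤0 ⟩
                v₀ x⁺ * s x + (- v₀ x) * s x⁺  ≈⟨ +-congˡ (trans
                  (*-congʳ (trans (-‿cong vx≈0) -0≈0)) (zeroˡ _)) ⟩
                v₀ x⁺ * s x + 0#               ≈⟨ +-identityʳ _ ⟩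
                v₀ x⁺ * s x                    ∎) ⟩
              s x              ≈⟨ +-identityˡ _ ⟨
              0# + s x         ≈⟨ +-congʳ (trans (*-congˡ vx≈0) (zeroʳ σ₀)) ⟨
              σ₀ * v₀ x + s x  ∎

        -- There may be infinitely many constraints, so `σ₀` is the supremum of the lower ones: `x⁺`
        -- makes this set inhabited and the root at `x⁻` bounds it.
        extension : ∃ λ σ₀ → ∀ x → 0# ≤ (σ₀ Vector.∷ σ) ∙ v x
        extension = σ₀ , extended-nonneg σ₀ above below
          where
          r₊ = root x⁺ (pos⇒≉0 0<v⁺)
          r₋ = root x⁻ (proj₂ v⁻<0)
          least = supremum LowerConstraint
            (proj₁ r₊ , x⁺ , 0<v⁺ , proj₂ r₊)
            (proj₁ r₋ , lower≤upper x⁻ v⁻<0 _ (proj₂ r₋))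
          σ₀ = proj₁ least
          above = proj₁ (proj₂ least)
          below = proj₂ (proj₂ least)

      module _ {w′ : Vector Carrier (suc k)} c x (w≈ : ∀ i → w i ≈ c * v x i + w′ i)
               (w′₀≈0 : w′ Fin.zero ≈ 0#) where

        ∙-tail : ∀ σ (σ₀ : Carrier) (u : Vector Carrier (suc k)) →
                 u Fin.zero ≈ 0# → σ ∙ tail u ≈ (σ₀ Vector.∷ σ) ∙ u
        ∙-tail σ σ₀ u u₀≈0 = sym (trans (+-congʳ (trans (*-congˡ u₀≈0) (zeroʳ σ₀))) (+-identityˡ _))

        -- A functional nonnegative on the eliminants extends to `τ`, nonnegative on all generators.
        -- Hence `τ` vanishes on the generators and on `w`, and so on the eliminants and on `w′`,
        -- which differs from `w` by a multiple of a generator.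
        tails-unseparated : Unseparated (λ z → tail (eliminant z)) (tail w′)
        tails-unseparated σ nonneg = eliminants≈0 , w′≈0
          where
          τ₀ = proj₁ (extension σ nonneg)
          τ = τ₀ Vector.∷ σ
          vanishes = unseparated τ (proj₂ (extension σ nonneg))

          eliminants≈0 : ∀ z → σ ∙ tail (eliminant z) ≈ 0#
          eliminants≈0 z@(x , y , _) = begin-equality
            σ ∙ tail (eliminant z)
              ≈⟨ ∙-tail σ τ₀ (eliminant z) (eliminant₀≈0 z) ⟩
            τ ∙ eliminant z                             ≈⟨ ∙-eliminant τ v z ⟩
            v₀ x * (τ ∙ v y) + (- v₀ y) * (τ ∙ v x)     ≈⟨ +-cong
              (trans (*-congˡ (proj₁ vanishes y)) (zeroʳ _))
              (trans (*-congˡ (proj₁ vanishes x)) (zeroʳ _)) ⟩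
            0# + 0#                                     ≈⟨ +-identityˡ 0# ⟩
            0#                                          ∎

          w′≈0 : σ ∙ tail w′ ≈ 0#
          w′≈0 = begin-equality
            σ ∙ tail w′                         ≈⟨ ∙-tail σ τ₀ w′ w′₀≈0 ⟩
            τ ∙ w′                              ≈⟨ +-identityˡ _ ⟨
            0# + τ ∙ w′
              ≈⟨ +-congʳ (trans (*-congˡ (proj₁ vanishes x)) (zeroʳ c)) ⟨
            c * (τ ∙ v x) + τ ∙ w′              ≈⟨ +-congʳ (∙-*-homoʳ c τ (v x)) ⟨
            τ ∙ (λ i → c * v x i) + τ ∙ w′      ≈⟨ ∙-distribˡ-+ τ (λ i → c * v x i) w′ ⟨
            τ ∙ (λ i → c * v x i + w′ i)        ≈⟨ ∙-congʳ τ w≈ ⟨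
            τ ∙ w                               ≈⟨ proj₂ vanishes ⟩
            0#                                  ∎

  solve-linear : ∀ {a} → a ≉ 0# → ∀ b → ∃ λ c → c * a ≈ b
  solve-linear {a} a≉0 b with inverse a a≉0
  ... | y , ay≈1 = b * y , trans
    (solve 3 (λ a b y → b :* y :* a := b :* (a :* y)) refl a b y)
    (trans (*-congˡ ay≈1) (*-identityʳ b))

  -- Fourier–Motzkin elimination of the first coordinate: the eliminants span
  -- the section of the cone by the hyperplane where that coordinate vanishes.
  unseparated⇒∈Cone : ∀ k {X : Set} (v : X → Vector Carrier k) w → Unseparated v w → Cone v w
  unseparated⇒∈Cone zero    v w unseparated = vertex (λ ())
  unseparated⇒∈Cone (suc k) {X} v w unseparated = cases em em
    where
    open FourierMotzkin v w unseparated

    first : Vector Carrier (suc k)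
    first = 1# Vector.∷ λ _ → 0#

    first-∙ : ∀ u → first ∙ u ≈ u Fin.zero
    first-∙ u = trans (+-cong (*-identityˡ _) (∙-zeroˡ (tail u))) (+-identityʳ _)

    -first-∙ : ∀ u → (λ i → - first i) ∙ u ≈ - u Fin.zero
    -first-∙ u = trans (∙-neg-homoˡ first u) (-‿cong (first-∙ u))

    -x≈0⇒x≈0 : ∀ {x} → - x ≈ 0# → x ≈ 0#
    -x≈0⇒x≈0 -x≈0 = trans (sym (-‿involutive _)) (trans (-‿cong -x≈0) -0≈0)

    flat : (∀ x → v₀ x ≤ 0#) → Cone v w
    flat v₀≤0 = Cone-untail v₀≈0 w₀≈0 (λ _ → refl)
      (unseparated⇒∈Cone k (λ x → tail (v x)) (tail w) λ σ nonneg →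
        let vanishes = unseparated (0# Vector.∷ σ) (λ x → ≤-respʳ-≈ (sym (0∷ σ (v x))) (nonneg x))
        in (λ x → trans (sym (0∷ σ (v x))) (proj₁ vanishes x))
         , trans (sym (0∷ σ w)) (proj₂ vanishes))
      where
      vanishes₀ = unseparated (λ i → - first i)
        (λ x → ≤-respʳ-≈ (sym (-first-∙ (v x))) (x≤0⇒0≤-x (v₀≤0 x)))
      v₀≈0 = λ x → -x≈0⇒x≈0 (trans (sym (-first-∙ (v x))) (proj₁ vanishes₀ x))
      w₀≈0 = -x≈0⇒x≈0 (trans (sym (-first-∙ w)) (proj₂ vanishes₀))
      0∷ : ∀ σ (u : Vector Carrier (suc k)) → (0# Vector.∷ σ) ∙ u ≈ σ ∙ tail u
      0∷ σ u = trans (+-congʳ (zeroˡ _)) (+-identityˡ _)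

    -- One generator accounts for the whole first coordinate of `w`; the remainder lies in the
    -- hyperplane, where the induction hypothesis applies to the eliminants.
    eliminate : ∀ x⁺ → 0# < v₀ x⁺ → ∀ x⁻ → v₀ x⁻ < 0# →
                ∀ c x → 0# ≤ c → c * v₀ x ≈ w Fin.zero → Cone v w
    eliminate x⁺ 0<v⁺ x⁻ v⁻<0 c x 0≤c c-solves = step c x 0≤c w≈
      (Cone-bind eliminant∈Cone (Cone-untail eliminant₀≈0 w′₀≈0 (λ _ → refl)
        (unseparated⇒∈Cone k _ (tail w′)
          (Extend.tails-unseparated x⁺ 0<v⁺ x⁻ v⁻<0 c x w≈ w′₀≈0))))
      where
      w′ : Vector Carrier (suc k)
      w′ i = w i - c * v x i
      w≈ : ∀ i → w i ≈ c * v x i + w′ i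
      w≈ i = solve 2 (λ w u → w := u :+ (w :- u)) refl (w i) (c * v x i)
      w′₀≈0 : w′ Fin.zero ≈ 0#
      w′₀≈0 = trans (+-congˡ (-‿cong c-solves)) (-‿inverseʳ _)

    cases : Dec (∃ λ x → 0# < v₀ x) → Dec (∃ λ x → v₀ x < 0#) → Cone v w
    cases (no ∄pos) _ = flat λ x → case ≤-or-> (v₀ x) 0# of λ
      { (inj₁ vx≤0) → vx≤0 ; (inj₂ 0<vx) → contradiction (x , 0<vx) ∄pos }
    -- The first coordinate would be a nonnegative functional that is nonzero at `x⁺`.
    cases (yes (x⁺ , 0<v⁺)) (no ∄neg) = contradiction
      (trans (sym (first-∙ (v x⁺))) (proj₁ (unseparated first nonneg) x⁺)) (pos⇒≉0 0<v⁺)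
      where
      nonneg : ∀ x → 0# ≤ first ∙ v x
      nonneg x with ≤-or-> 0# (v₀ x)
      ... | inj₁ 0≤vx = ≤-respʳ-≈ (sym (first-∙ (v x))) 0≤vx
      ... | inj₂ vx<0 = contradiction (x , vx<0) ∄neg
    -- The sign of the first coordinate of `w` decides which of `x⁺` and `x⁻` yields a nonnegative
    -- coefficient.
    cases (yes (x⁺ , 0<v⁺)) (yes (x⁻ , v⁻<0)) with total 0# (w Fin.zero)
    ... | inj₁ 0≤w₀ = let c , c-solves = solve-linear (pos⇒≉0 0<v⁺) (w Fin.zero) in
      eliminate x⁺ 0<v⁺ x⁻ v⁻<0 c x⁺
        (*-cancel-nonneg 0<v⁺ (≤-respʳ-≈ (trans (sym c-solves) (*-comm c _)) 0≤w₀)) c-solves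
    ... | inj₂ w₀≤0 = let c , c-solves = solve-linear (proj₂ v⁻<0) (w Fin.zero) in
      eliminate x⁺ 0<v⁺ x⁻ v⁻<0 c x⁻
        (*-cancel-nonneg (x<0⇒0<-x v⁻<0) (≤-respʳ-≈
          (trans (-‿cong (sym c-solves))
                 (solve 2 (λ c a → :- (c :* a) := (:- a) :* c) refl c (v₀ x⁻)))
          (x≤0⇒0≤-x w₀≤0))) c-solves

-- Truncated difference in MV-algebras.

module MVAlgebraProperties {c ℓ} (𝐀 : MVAlgebra c ℓ) where
  open MVAlgebra 𝐀 renaming (¬_ to neg)
  open IsCommutativeMonoid isCommutativeMonoid
    using (refl; sym; trans; ∙-congˡ; ∙-congʳ; assoc; comm)

  -- In the standard algebra this is the maximum of 0 and x - y. The axiom `łukasiewicz` says that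
  -- `(x ⊖ y) ⊕ y` is symmetric; it is the join.
  infixl 6 _⊖_
  _⊖_ : Carrier → Carrier → Carrier
  x ⊖ y = neg (neg x ⊕ y)

  -- Apply `łukasiewicz` to `𝟙` and `x`: one side is `neg x ⊕ x`, the other is absorbed by `𝟙`.
  x⊕¬x≈𝟙 : ∀ x → x ⊕ neg x ≈ 𝟙
  x⊕¬x≈𝟙 x = trans (comm x (neg x)) (trans (∙-congʳ ¬x≈𝟙⊖x)
    (trans (łukasiewicz 𝟙 x) (⊕-zeroʳ (x ⊖ 𝟙))))
    where
    ¬x≈𝟙⊖x : neg x ≈ 𝟙 ⊖ x
    ¬x≈𝟙⊖x = ¬-cong (sym (trans (∙-congʳ (¬-involutive 𝟘))
      (IsCommutativeMonoid.identityˡ isCommutativeMonoid x)))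

  ≈𝟙⇒¬≈𝟘 : ∀ {x} → x ≈ 𝟙 → neg x ≈ 𝟘
  ≈𝟙⇒¬≈𝟘 x≈𝟙 = trans (¬-cong x≈𝟙) (¬-involutive 𝟘)

  x⊙¬x≈𝟘 : ∀ x → x ⊙ neg x ≈ 𝟘
  x⊙¬x≈𝟘 x = ≈𝟙⇒¬≈𝟘 (x⊕¬x≈𝟙 (neg x))

  [x⊖y]⊙y≈𝟘 : ∀ x y → (x ⊖ y) ⊙ y ≈ 𝟘
  [x⊖y]⊙y≈𝟘 x y = ≈𝟙⇒¬≈𝟘 (trans (∙-congʳ (¬-involutive (neg x ⊕ y)))
    (trans (assoc (neg x) y (neg y)) (trans (∙-congˡ (x⊕¬x≈𝟙 y)) (⊕-zeroʳ (neg x)))))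

-- Measures on an MV-algebra and integer approximation.

module Measures (em : ExcludedMiddle 0ℓ) (ℝ : CompleteOrderedField)
                {c ℓ} (𝐀 : MVAlgebra c ℓ) where

  open CompleteOrderedField ℝ
  open OrderedFieldProperties ℝ
  open CompleteOrderedFieldProperties em ℝ
  open McNaughtonFunctions ℝ using (State; Faithful)
  open ≤-Reasoning
  open MVAlgebraProperties 𝐀
  open CommutativeSemigroupProperties +-commutativeSemigroup using (interchange)
  private
    module 𝐀 where
      open MVAlgebra 𝐀 public
      open IsCommutativeMonoid isCommutativeMonoid public using (sym; trans; identityˡ)

  -- States without normalisation: unlike states they are closed under sums and nonnegative
  -- multiples, so point masses can be added freely.
  record Measure : Set (c L.⊔ ℓ) where
    field
      value    : 𝐀.Carrier → Carrier
      cong     : ∀ {a b} → a 𝐀.≈ b → value a ≈ value b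
      nonneg   : ∀ a → 0# ≤ value a
      additive : ∀ a b → a 𝐀.⊙ b 𝐀.≈ 𝐀.𝟘 → value (a 𝐀.⊕ b) ≈ value a + value b

    mass : Carrier
    mass = value 𝐀.𝟙

    value-𝟘 : value 𝐀.𝟘 ≈ 0#
    value-𝟘 = +-cancelˡ (value 𝐀.𝟘) _ _ (begin-equality
      value 𝐀.𝟘 + value 𝐀.𝟘  ≈⟨ additive 𝐀.𝟘 𝐀.𝟘 (≈𝟙⇒¬≈𝟘 (𝐀.⊕-zeroʳ 𝐀.𝟙)) ⟨
      value (𝐀.𝟘 𝐀.⊕ 𝐀.𝟘)     ≈⟨ cong (𝐀.identityˡ 𝐀.𝟘) ⟩
      value 𝐀.𝟘               ≈⟨ +-identityʳ _ ⟨
      value 𝐀.𝟘 + 0#          ∎)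

    value≤mass : ∀ a → value a ≤ mass
    value≤mass a = begin
      value a                    ≤⟨ x≤x+y (nonneg (𝐀.¬ a)) ⟩
      value a + value (𝐀.¬ a)    ≈⟨ additive a (𝐀.¬ a) (x⊙¬x≈𝟘 a) ⟨
      value (a 𝐀.⊕ 𝐀.¬ a)        ≈⟨ cong (x⊕¬x≈𝟙 a) ⟩
      mass                       ∎

    -- Both sides are the value of the join of `a` and `b`.
    exchange : ∀ a b → value (a ⊖ b) + value b ≈ value (b ⊖ a) + value a
    exchange a b = begin-equality
      value (a ⊖ b) + value b    ≈⟨ additive (a ⊖ b) b ([x⊖y]⊙y≈𝟘 a b) ⟨
      value ((a ⊖ b) 𝐀.⊕ b)      ≈⟨ cong (𝐀.łukasiewicz a b) ⟩
      value ((b ⊖ a) 𝐀.⊕ a)      ≈⟨ additive (b ⊖ a) a ([x⊖y]⊙y≈𝟘 b a) ⟩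
      value (b ⊖ a) + value a    ∎

    -- A list stands for the untruncated sum of its entries, which need not be an element of the
    -- algebra.
    listValue : List 𝐀.Carrier → Carrier
    listValue []      = 0#
    listValue (a ∷ A) = value a + listValue A

    listValue-nonneg : ∀ A → 0# ≤ listValue A
    listValue-nonneg []      = ≤-refl
    listValue-nonneg (a ∷ A) = +-nonneg (nonneg a) (listValue-nonneg A)

    listValue-replicate-++ : ∀ m a A →
      listValue (replicate m a ++ A) ≈ m · 1# * value a + listValue A
    listValue-replicate-++ zero    a A = sym (trans (+-congʳ (zeroˡ _)) (+-identityˡ _))
    listValue-replicate-++ (suc m) a A = trans (+-congˡ (listValue-replicate-++ m a A))
      (trans (+-congʳ (sym (*-identityˡ _)))
        (solve 4 (λ o m a t → o :* a :+ (m :* a :+ t) := (o :+ m) :* a :+ t)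
                 refl 1# (m · 1#) (value a) (listValue A)))

  open Measure public using (value; mass; listValue; listValue-replicate-++; listValue-nonneg)

  stateMeasure : State 𝐀 → Measure
  stateMeasure s = record
    { value    = State.value s
    ; cong     = Func.cong (State.function s)
    ; nonneg   = λ a → proj₁ (proj₂ (Func.to (State.function s) a))
    ; additive = State.additive s
    }

  infixl 6 _+ₘ_
  _+ₘ_ : Measure → Measure → Measure
  μ +ₘ ν = record
    { value    = λ a → value μ a + value ν a
    ; cong     = λ a≈b → +-cong (Measure.cong μ a≈b) (Measure.cong ν a≈b)
    ; nonneg   = λ a → +-nonneg (Measure.nonneg μ a) (Measure.nonneg ν a)
    ; additive = λ a b a⊙b≈𝟘 → trans
        (+-cong (Measure.additive μ a b a⊙b≈𝟘) (Measure.additive ν a b a⊙b≈𝟘))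
        (solve 4 (λ p q r s → (p :+ q) :+ (r :+ s) := (p :+ r) :+ (q :+ s)) refl _ _ _ _)
    }

  scale : ∀ c → 0# ≤ c → Measure → Measure
  scale c 0≤c μ = record
    { value    = λ a → c * value μ a
    ; cong     = λ a≈b → *-congˡ (Measure.cong μ a≈b)
    ; nonneg   = λ a → *-nonneg 0≤c (Measure.nonneg μ a)
    ; additive = λ a b a⊙b≈𝟘 → trans (*-congˡ (Measure.additive μ a b a⊙b≈𝟘)) (distribˡ _ _ _)
    }

  normalise : (μ : Measure) → 0# < mass μ →
              ∃ λ (s : State 𝐀) → ∀ a → mass μ * State.value s a ≈ value μ a
  normalise μ 0<M = record
    { function   = record
      { to   = λ a → value ν a , Measure.nonneg ν a , ≤-respʳ-≈ ν1≈1 (Measure.value≤mass ν a)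
      ; cong = Measure.cong ν
      }
    ; normalised = ν1≈1
    ; additive   = Measure.additive ν
    } , λ a → trans (sym (*-assoc _ _ _)) (trans (*-congʳ Mc≈1) (*-identityˡ _))
    where
    M⁻¹ = proj₁ (inverse-pos 0<M)
    Mc≈1 = proj₂ (proj₂ (inverse-pos 0<M))
    ν = scale M⁻¹ (proj₁ (proj₁ (proj₂ (inverse-pos 0<M)))) μ
    ν1≈1 = trans (*-comm _ _) Mc≈1

  private
    combine : ∀ P Q v A B → (P - Q) * v + (A - B) ≈ (P * v + A) - (Q * v + B)
    combine = solve 5 (λ p q v a b →
      (p :- q) :* v :+ (a :- b) := (p :* v :+ a) :- (q :* v :+ b)) refl

    combine-lower : ∀ {s S P Q v A B} → 0# ≤ v → P - Q ≤ s → A - B ≤ S →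
                    (P * v + A) - (Q * v + B) ≤ s * v + S
    combine-lower 0≤v lower rest = ≤-respˡ-≈ (combine _ _ _ _ _)
      (+-mono-≤ (*-monoˡ-≤-nonneg 0≤v lower) rest)

    combine-upper : ∀ {s S P Q v A B K M} → 0# ≤ v → v ≤ M → s ≤ (P - Q) + 1# →
                    S ≤ (A - B) + K * M →
                    s * v + S ≤ ((P * v + A) - (Q * v + B)) + (1# + K) * M
    combine-upper {s} {S} {P} {Q} {v} {A} {B} {K} {M} 0≤v v≤M upper rest = begin
      s * v + S
        ≤⟨ +-mono-≤ (*-monoˡ-≤-nonneg 0≤v upper) rest ⟩
      ((P - Q) + 1#) * v + ((A - B) + K * M)
        ≈⟨ +-congʳ (distribʳ v (P - Q) 1#) ⟩
      ((P - Q) * v + 1# * v) + ((A - B) + K * M)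
        ≈⟨ interchange _ _ _ _ ⟩
      ((P - Q) * v + (A - B)) + (1# * v + K * M)
        ≤⟨ +-monoʳ-≤ _ (+-monoˡ-≤ _ (*-monoʳ-≤-nonneg 0≤1 v≤M)) ⟩
      ((P - Q) * v + (A - B)) + (1# * M + K * M)
        ≈⟨ +-cong (combine P Q v A B) (sym (distribʳ M 1# K)) ⟩
      ((P * v + A) - (Q * v + B)) + (1# + K) * M ∎

  IntegerApproximation : ∀ {k} → Vector Carrier k → Vector 𝐀.Carrier k →
                         List 𝐀.Carrier → List 𝐀.Carrier → Measure → Set
  IntegerApproximation {k} σ h A B μ =
    listValue μ A - listValue μ B ≤ σ ∙ (value μ ∘ h) ×
    σ ∙ (value μ ∘ h) ≤ (listValue μ A - listValue μ B) + k · 1# * mass μ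

  -- Rounding each coefficient down to an integer costs at most `mass μ` per term. The lists do not
  -- depend on `μ`, so comparisons made at points can be carried over to any measure.
  approximate : ∀ {k} (σ : Vector Carrier k) (h : Vector 𝐀.Carrier k) →
    ∃ λ A → ∃ λ B → ∀ μ → IntegerApproximation σ h A B μ
  approximate {zero} σ h = [] , [] , λ μ →
      ≤-reflexive (-‿inverseʳ 0#)
    , ≤-reflexive (sym (trans (+-cong (-‿inverseʳ 0#) (zeroˡ _)) (+-identityˡ 0#)))
  approximate {suc k} σ h =
    let p , q , lower , upper = integer-part (σ Fin.zero)
        A , B , rest          = approximate (tail σ) (tail h)
    in replicate p h₀ ++ A , replicate q h₀ ++ B , λ μ → extend μ p q A B lower upper (rest μ)
    where
    h₀ = h Fin.zero

    extend : ∀ μ p q A B → p · 1# - q · 1# ≤ σ Fin.zero →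
             σ Fin.zero ≤ (p · 1# - q · 1#) + 1# →
             IntegerApproximation (tail σ) (tail h) A B μ →
             IntegerApproximation σ h (replicate p h₀ ++ A) (replicate q h₀ ++ B) μ
    extend μ p q A B lower upper rest =
        ≤-respˡ-≈ (sym difference)
          (combine-lower (Measure.nonneg μ h₀) lower (proj₁ rest))
      , ≤-respʳ-≈ (+-congʳ (sym difference))
          (combine-upper (Measure.nonneg μ h₀) (Measure.value≤mass μ h₀) upper (proj₂ rest))
      where
      difference = +-cong
        (listValue-replicate-++ μ p h₀ A)
        (-‿cong (listValue-replicate-++ μ q h₀ B))

  -- An abstraction of the points of the cube. By `linear`, the values at one point are totally
  -- ordered: of two opposite truncated differences, one vanishes there.
  record SeparatingFamily : Set (L.suc 0ℓ L.⊔ c L.⊔ ℓ) where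
    field
      Index      : Set
      evaluation : Index → Measure

    infix 9 _⟪_⟫
    _⟪_⟫ : 𝐀.Carrier → Index → Carrier
    a ⟪ x ⟫ = value (evaluation x) a

    field
      separating : ∀ a → (∀ x → a ⟪ x ⟫ ≈ 0#) → a 𝐀.≈ 𝐀.𝟘
      linear     : ∀ a b x → (a ⊖ b) ⟪ x ⟫ ≈ 0# ⊎ (b ⊖ a) ⟪ x ⟫ ≈ 0#

-- From inequalities at points to inequalities for measures.

module Positivity (em : ExcludedMiddle 0ℓ) (ℝ : CompleteOrderedField)
  {c ℓ} (𝐀 : MVAlgebra c ℓ) (ℰ : Measures.SeparatingFamily em ℝ 𝐀) where

  open CompleteOrderedField ℝ
  open OrderedFieldProperties ℝ
  open CompleteOrderedFieldProperties em ℝ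
  open ≤-Reasoning
  open RingProperties ring using (-1*x≈-x)
  open Measures em ℝ 𝐀
  open MVAlgebraProperties 𝐀 using (_⊖_)
  open SeparatingFamily ℰ
  private
    module 𝐀 = MVAlgebra 𝐀

  -- The relation between the positive and the negative part of a function.
  Disjoint : List 𝐀.Carrier → List 𝐀.Carrier → Set
  Disjoint A B = ∀ x → listValue (evaluation x) A ≈ 0# ⊎ listValue (evaluation x) B ≈ 0#

  -- Each entry `a` absorbs what it can of `b`, leaving `a ⊖ b`, and passes `b ⊖ a` on; `r` is what
  -- remains at the end. By `exchange`, the balance holds for every measure.
  subtract₁ : ∀ b A → ∃ λ A′ → ∃ λ r →
    (∀ μ → listValue μ A + value μ r ≈ listValue μ A′ + value μ b) × Disjoint (r ∷ []) A′
  subtract₁ b []      = [] , b , (λ _ → refl) , (λ _ → inj₂ refl)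
  subtract₁ b (a ∷ A) with subtract₁ (b ⊖ a) A
  ... | A′ , r , balanced , disjoint = (a ⊖ b) ∷ A′ , r , balanced′ , λ x → disjoint′ x
      (disjoint x) (linear a b x)
    where
    balanced′ : ∀ μ → listValue μ (a ∷ A) + value μ r ≈ listValue μ ((a ⊖ b) ∷ A′) + value μ b
    balanced′ μ = let v = value μ ; T = listValue μ in begin-equality
      (v a + T A) + v r              ≈⟨ +-assoc _ _ _ ⟩
      v a + (T A + v r)              ≈⟨ +-congˡ (balanced μ) ⟩
      v a + (T A′ + v (b ⊖ a))       ≈⟨ solve 3 (λ a t d → a :+ (t :+ d) := t :+ (d :+ a))
                                              refl (v a) (T A′) (v (b ⊖ a)) ⟩
      T A′ + (v (b ⊖ a) + v a)       ≈⟨ +-congˡ (Measure.exchange μ b a) ⟩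
      T A′ + (v (a ⊖ b) + v b)       ≈⟨ solve 3 (λ t d b → t :+ (d :+ b) := (d :+ t) :+ b)
                                              refl (T A′) (v (a ⊖ b)) (v b) ⟩
      (v (a ⊖ b) + T A′) + v b       ∎

    disjoint′ : ∀ x → listValue (evaluation x) (r ∷ []) ≈ 0# ⊎ listValue (evaluation x) A′ ≈ 0# →
                (a ⊖ b) ⟪ x ⟫ ≈ 0# ⊎ (b ⊖ a) ⟪ x ⟫ ≈ 0# →
                listValue (evaluation x) (r ∷ []) ≈ 0# ⊎
                listValue (evaluation x) ((a ⊖ b) ∷ A′) ≈ 0#
    disjoint′ x (inj₁ r≈0)  _           = inj₁ r≈0
    disjoint′ x (inj₂ A′≈0) (inj₁ a⊖b≈0) =
      inj₂ (trans (+-cong a⊖b≈0 A′≈0) (+-identityʳ 0#))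
    -- At such a point the right side of the balance is zero, hence so is `r`.
    disjoint′ x (inj₂ A′≈0) (inj₂ b⊖a≈0) = inj₁ (trans (+-identityʳ _) (antisym
      (begin
        r ⟪ x ⟫                                  ≤⟨ x≤x+y (listValue-nonneg (evaluation x) A) ⟩
        r ⟪ x ⟫ + listValue (evaluation x) A     ≈⟨ +-comm _ _ ⟩
        listValue (evaluation x) A + r ⟪ x ⟫     ≈⟨ balanced (evaluation x) ⟩
        listValue (evaluation x) A′ + (b ⊖ a) ⟪ x ⟫ ≈⟨ +-cong A′≈0 b⊖a≈0 ⟩
        0# + 0#                                  ≈⟨ +-identityʳ 0# ⟩
        0#                                       ∎)
      (Measure.nonneg (evaluation x) r)))

  -- Truncated difference of sums: A′ represents (A - B)⁺ and R represents (B - A)⁺.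
  subtract : ∀ B A → ∃ λ A′ → ∃ λ R →
    (∀ μ → listValue μ A + listValue μ R ≈ listValue μ A′ + listValue μ B) × Disjoint R A′
  subtract []      A = A , [] , (λ _ → refl) , (λ _ → inj₁ refl)
  subtract (b ∷ B) A with subtract₁ b A
  ... | A₁ , r , balanced₁ , disjoint₁ with subtract B A₁
  ...   | A₂ , R , balanced₂ , disjoint₂ =
      A₂ , r ∷ R , balanced , λ x → disjoint x (disjoint₁ x) (disjoint₂ x)
    where
    balanced : ∀ μ → listValue μ A + listValue μ (r ∷ R) ≈ listValue μ A₂ + listValue μ (b ∷ B)
    balanced μ = let v = value μ ; T = listValue μ in begin-equality
      T A + (v r + T R)     ≈⟨ +-assoc _ _ _ ⟨
      (T A + v r) + T R     ≈⟨ +-congʳ (balanced₁ μ) ⟩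
      (T A₁ + v b) + T R    ≈⟨ solve 3 (λ a b r → (a :+ b) :+ r := (a :+ r) :+ b)
                                     refl (T A₁) (v b) (T R) ⟩
      (T A₁ + T R) + v b    ≈⟨ +-congʳ (balanced₂ μ) ⟩
      (T A₂ + T B) + v b    ≈⟨ solve 3 (λ a b r → (a :+ b) :+ r := a :+ (r :+ b))
                                     refl (T A₂) (T B) (v b) ⟩
      T A₂ + (v b + T B)    ∎

    disjoint : ∀ x → listValue (evaluation x) (r ∷ []) ≈ 0# ⊎ listValue (evaluation x) A₁ ≈ 0# →
               listValue (evaluation x) R ≈ 0# ⊎ listValue (evaluation x) A₂ ≈ 0# →
               listValue (evaluation x) (r ∷ R) ≈ 0# ⊎ listValue (evaluation x) A₂ ≈ 0#
    disjoint x _           (inj₂ A₂≈0) = inj₂ A₂≈0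
    disjoint x (inj₁ r≈0)  (inj₁ R≈0)  =
      inj₁ (trans (+-congˡ R≈0) r≈0)
    disjoint x (inj₂ A₁≈0) (inj₁ R≈0)  = inj₂ (antisym
      (begin
        T A₂          ≤⟨ x≤x+y (listValue-nonneg (evaluation x) B) ⟩
        T A₂ + T B    ≈⟨ balanced₂ (evaluation x) ⟨
        T A₁ + T R    ≈⟨ +-cong A₁≈0 R≈0 ⟩
        0# + 0#       ≈⟨ +-identityʳ 0# ⟩
        0#            ∎)
      (listValue-nonneg (evaluation x) A₂))
      where T = listValue (evaluation x)

  -- Nonnegative summands with zero sum vanish at every point, so `separating` makes each of them
  -- zero in the algebra.
  vanishing⇒listValue≈0 : ∀ R → (∀ x → listValue (evaluation x) R ≈ 0#) → ∀ μ → listValue μ R ≈ 0#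
  vanishing⇒listValue≈0 []      R≈0 μ = refl
  vanishing⇒listValue≈0 (r ∷ R) R≈0 μ = trans
    (+-cong (trans (Measure.cong μ (separating r (λ x → proj₁ (both x)))) (Measure.value-𝟘 μ))
            (vanishing⇒listValue≈0 R (λ x → proj₂ (both x)) μ))
    (+-identityʳ 0#)
    where
    both : ∀ x → r ⟪ x ⟫ ≈ 0# × listValue (evaluation x) R ≈ 0#
    both x = x+y≈0⇒x≈0∧y≈0 (Measure.nonneg (evaluation x) r)
                             (listValue-nonneg (evaluation x) R) (R≈0 x)

  -- The list `R` for the positive part of B - A vanishes at every point and so has value zero under
  -- `μ`; the balance then gives the inequality.
  listValue-mono : ∀ A B → (∀ x → listValue (evaluation x) B ≤ listValue (evaluation x) A) →
                   ∀ μ → listValue μ B ≤ listValue μ A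
  listValue-mono A B B≤A μ with subtract B A
  ... | A′ , R , balanced , disjoint = begin
      listValue μ B                   ≤⟨ x≤x+y (listValue-nonneg μ A′) ⟩
      listValue μ B + listValue μ A′  ≈⟨ +-comm _ _ ⟩
      listValue μ A′ + listValue μ B  ≈⟨ balanced μ ⟨
      listValue μ A + listValue μ R
        ≈⟨ +-congˡ (vanishing⇒listValue≈0 R (λ x → R≈0 x (disjoint x)) μ) ⟩
      listValue μ A + 0#              ≈⟨ +-identityʳ _ ⟩
      listValue μ A                   ∎
    where
    R≈0 : ∀ x → listValue (evaluation x) R ≈ 0# ⊎ listValue (evaluation x) A′ ≈ 0# →
          listValue (evaluation x) R ≈ 0#
    R≈0 x (inj₁ R≈0)  = R≈0
    R≈0 x (inj₂ A′≈0) = antisym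
      (x+y≤x⇒y≤0 (begin
        T A + T R    ≈⟨ balanced (evaluation x) ⟩
        T A′ + T B   ≈⟨ trans (+-congʳ A′≈0) (+-identityˡ _) ⟩
        T B          ≤⟨ B≤A x ⟩
        T A          ∎))
      (listValue-nonneg (evaluation x) R)
      where T = listValue (evaluation x)

  private
    absorb : ∀ {A B K S} → 0# ≤ S → S ≤ (A - B) + K → B ≤ K + A
    absorb {A} {B} {K} {S} 0≤S S≤A-B+K = 0≤y-x⇒x≤y (≤-respʳ-≈
      (solve 3 (λ a b k → (a :- b) :+ k := (k :+ a) :- b) refl A B K) (≤-trans 0≤S S≤A-B+K))

    squeeze : ∀ {A B K S} → A - B ≤ S → B ≤ K + A → - S ≤ K
    squeeze {A} {B} {K} {S} A-B≤S B≤K+A = 0≤y-x⇒x≤y (≤-respʳ-≈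
      (solve 4 (λ a b k s → (s :- (a :- b)) :+ ((k :+ a) :- b) := k :- (:- s)) refl A B K S)
      (+-nonneg (x≤y⇒0≤y-x A-B≤S) (x≤y⇒0≤y-x B≤K+A)))

  module _ {k} (σ : Vector Carrier k) (h : Vector 𝐀.Carrier k)
           (σ∙h≥0 : ∀ x → 0# ≤ σ ∙ (_⟪ x ⟫ ∘ h)) where

    scaled-nonneg : ∀ m x → 0# ≤ (λ i → m · 1# * σ i) ∙ (_⟪ x ⟫ ∘ h)
    scaled-nonneg m x = ≤-respʳ-≈ (sym (∙-*-homoˡ (m · 1#) σ (_⟪ x ⟫ ∘ h)))
      (*-nonneg (·1-nonneg m) (σ∙h≥0 x))

    -- Archimedean argument: the error k · mass of the approximation of m σ does
    -- not grow with m.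
    positive : ∀ μ → 0# ≤ σ ∙ (value μ ∘ h)
    positive μ = case ≤-or-> 0# S of λ
      { (inj₁ 0≤S) → 0≤S
      ; (inj₂ S<0) → let m , K<m*-S = archimedean-pos (x<0⇒0<-x S<0) K in
          contradiction (-mS≤K m) (<⇒≱ (<-resp-≈ refl
            (solve 2 (λ m s → m :* (:- s) := :- (m :* s)) refl (m · 1#) S) K<m*-S)) }
      where
      S = σ ∙ (value μ ∘ h)
      K = k · 1# * mass μ

      -mS≤K : ∀ m → - (m · 1# * S) ≤ K
      -mS≤K m = ≤-respˡ-≈ (-‿cong (∙-*-homoˡ (m · 1#) σ (value μ ∘ h)))
        (squeeze (proj₁ (close μ)) B≤K+A)
        where
        approximation = approximate (λ i → m · 1# * σ i) h
        A = proj₁ approximation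
        B = proj₁ (proj₂ approximation)
        close = proj₂ (proj₂ approximation)

        -- Prepending `k` copies of `𝟙` to `A` turns the error term into part of a list, so that
        -- `listValue-mono` applies.
        B≤K+A : listValue μ B ≤ K + listValue μ A
        B≤K+A = ≤-respʳ-≈ (listValue-replicate-++ μ k 𝐀.𝟙 A)
          (listValue-mono (replicate k 𝐀.𝟙 ++ A) B (λ x →
            ≤-respʳ-≈ (sym (listValue-replicate-++ (evaluation x) k 𝐀.𝟙 A))
              (absorb (scaled-nonneg m x) (proj₂ (close (evaluation x))))) μ)

  -- Faithfulness speaks of single elements, so one summand is taken from the list; nonnegativity of
  -- the others keeps it below the sum.
  positive-member : ∀ A x → 0# < listValue (evaluation x) A →
    ∃ λ a → 0# < a ⟪ x ⟫ × (∀ y → a ⟪ y ⟫ ≤ listValue (evaluation y) A)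
  positive-member []      x 0<0 = contradiction refl (proj₂ 0<0)
  positive-member (a ∷ A) x 0<a+A with ≤-or-> (a ⟪ x ⟫) 0#
  ... | inj₂ 0<a = a , 0<a , λ y → x≤x+y (listValue-nonneg (evaluation y) A)
  ... | inj₁ a≤0 =
    let b , 0<b , b≤A = positive-member A x
          (<-≤-trans 0<a+A (≤-respʳ-≈ (+-identityˡ _) (+-monoˡ-≤ _ a≤0)))
    in b , 0<b , λ y → ≤-trans (b≤A y) (≤-respʳ-≈ (+-comm _ _)
         (x≤x+y (Measure.nonneg (evaluation y) a)))

  module _ {k} (σ : Vector Carrier k) (h : Vector 𝐀.Carrier k)
           (σ∙h≥0 : ∀ x → 0# ≤ σ ∙ (_⟪ x ⟫ ∘ h))
           (x₀ : Index) (0<σ∙h : 0# < σ ∙ (_⟪ x₀ ⟫ ∘ h)) where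

    -- For `m` so large that the combination times `m` exceeds the rounding error at `x₀`, the
    -- integer approximation A - B stays positive there. Its positive part `A′` lies below that
    -- multiple everywhere, and `g` is one of its members.
    minorant : ∃ λ m → ∃ λ g → 0# < g ⟪ x₀ ⟫ × (∀ x → g ⟪ x ⟫ ≤ m · 1# * (σ ∙ (_⟪ x ⟫ ∘ h)))
    minorant = m , proj₁ member , proj₁ (proj₂ member) ,
      λ x → ≤-trans (proj₂ (proj₂ member) x) (A′≤ x (disjoint x))
      where
      K = k · 1# * mass (evaluation x₀)
      m = proj₁ (archimedean-pos 0<σ∙h K)
      approximation = approximate (λ i → m · 1# * σ i) h
      A = proj₁ approximation
      B = proj₁ (proj₂ approximation)
      close = proj₂ (proj₂ approximation)
      subtraction = subtract B A
      A′ = proj₁ subtraction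
      R = proj₁ (proj₂ subtraction)
      balanced = proj₁ (proj₂ (proj₂ subtraction))
      disjoint = proj₂ (proj₂ (proj₂ subtraction))
      T : Index → List 𝐀.Carrier → Carrier
      T x = listValue (evaluation x)

      scaled : ∀ x → (λ i → m · 1# * σ i) ∙ (_⟪ x ⟫ ∘ h) ≈ m · 1# * (σ ∙ (_⟪ x ⟫ ∘ h))
      scaled x = ∙-*-homoˡ (m · 1#) σ (_⟪ x ⟫ ∘ h)

      A′≈A-B+R : ∀ x → T x A′ ≈ (T x A - T x B) + T x R
      A′≈A-B+R x = begin-equality
        T x A′                       ≈⟨ solve 2 (λ a b → a := (a :+ b) :- b) refl (T x A′) (T x B) ⟩
        (T x A′ + T x B) - T x B     ≈⟨ +-congʳ (balanced (evaluation x)) ⟨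
        (T x A + T x R) - T x B      ≈⟨ solve 3 (λ a r b → (a :+ r) :- b := (a :- b) :+ r)
                                              refl (T x A) (T x R) (T x B) ⟩
        (T x A - T x B) + T x R      ∎

      0<A-B : 0# < T x₀ A - T x₀ B
      0<A-B = <-resp-≈ (-‿inverseʳ K)
        (solve 2 (λ d k → (d :+ k) :- k := d) refl (T x₀ A - T x₀ B) K)
        (+-monoˡ-< (- K) (<-≤-trans (proj₂ (archimedean-pos 0<σ∙h K))
          (≤-respˡ-≈ (scaled x₀) (proj₂ (close (evaluation x₀))))))

      member = positive-member A′ x₀ (<-≤-trans 0<A-B
        (≤-respʳ-≈ (sym (A′≈A-B+R x₀)) (x≤x+y (listValue-nonneg (evaluation x₀) R))))

      A′≤ : ∀ x → T x R ≈ 0# ⊎ T x A′ ≈ 0# → T x A′ ≤ m · 1# * (σ ∙ (_⟪ x ⟫ ∘ h))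
      A′≤ x (inj₂ A′≈0) = ≤-respˡ-≈ (sym A′≈0) (*-nonneg (·1-nonneg m) (σ∙h≥0 x))
      A′≤ x (inj₁ R≈0)  = ≤-respˡ-≈
        (sym (trans (A′≈A-B+R x) (trans (+-congˡ R≈0) (+-identityʳ _))))
        (≤-respʳ-≈ (scaled x) (proj₁ (close (evaluation x))))

    -- Applying `positive` to `m` times the combination minus the minorant `g` bounds `value μ g` by
    -- `m` times the value; were the latter nonpositive, `g` would have value zero.
    strictly-positive : ∀ μ → (∀ g → ¬ g 𝐀.≈ 𝐀.𝟘 → value μ g ≉ 0#) → 0# < σ ∙ (value μ ∘ h)
    strictly-positive μ faithful = case ≤-or-> (σ ∙ (value μ ∘ h)) 0# of λ
      { (inj₂ 0<S) → 0<S
      ; (inj₁ S≤0) → contradiction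
          (antisym (≤-trans g≤mS (≤-respʳ-≈ (zeroʳ _) (*-monoʳ-≤-nonneg (·1-nonneg m) S≤0)))
                   (Measure.nonneg μ g))
          (faithful g λ g≈𝟘 → proj₂ 0<g (sym
            (trans (Measure.cong (evaluation x₀) g≈𝟘) (Measure.value-𝟘 (evaluation x₀))))) }
      where
      m = proj₁ minorant
      g = proj₁ (proj₂ minorant)
      0<g = proj₁ (proj₂ (proj₂ minorant))
      g≤ = proj₂ (proj₂ (proj₂ minorant))

      τ : Vector Carrier (suc k)
      τ = (- 1#) Vector.∷ λ i → m · 1# * σ i

      τ∙ : ∀ ν → τ ∙ (value ν ∘ (g Vector.∷ h)) ≈ m · 1# * (σ ∙ (value ν ∘ h)) - value ν g
      τ∙ ν = trans (+-cong (-1*x≈-x (value ν g)) (∙-*-homoˡ (m · 1#) σ (value ν ∘ h))) (+-comm _ _)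

      g≤mS : value μ g ≤ m · 1# * (σ ∙ (value μ ∘ h))
      g≤mS = 0≤y-x⇒x≤y (≤-respʳ-≈ (τ∙ μ) (positive τ (g Vector.∷ h)
        (λ x → ≤-respʳ-≈ (sym (τ∙ (evaluation x))) (x≤y⇒0≤y-x (g≤ x))) μ))

-- Strict coherence and faithful states over a separating family.

module Coherence (em : ExcludedMiddle 0ℓ) (ℝ : CompleteOrderedField)
  {c ℓ} (𝐀 : MVAlgebra c ℓ) (ℰ : Measures.SeparatingFamily em ℝ 𝐀)
  {k} (f : Vector (MVAlgebra.Carrier 𝐀) k) (b : Vector (CompleteOrderedField.Carrier ℝ) k) where

  open CompleteOrderedField ℝ
  open OrderedFieldProperties ℝ
  open CompleteOrderedFieldProperties em ℝ
  open ConvexCones em ℝ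
  open McNaughtonFunctions ℝ using (State; Faithful)
  open ≤-Reasoning
  open Measures em ℝ 𝐀
  open SeparatingFamily ℰ
  open Positivity em ℝ 𝐀 ℰ
  private
    module 𝐀 = MVAlgebra 𝐀

  -- The factor `mass μ` makes the gain additive and homogeneous in `μ`. For positive mass it
  -- vanishes exactly when the normalised measure extends the book.
  gain : Measure → Vector Carrier k
  gain μ i = mass μ * b i - value μ (f i)

  Coherent : Set
  Coherent = ∀ σ → (∃ λ x → σ ∙ gain (evaluation x) < 0#) → ∃ λ x → 0# < σ ∙ gain (evaluation x)

  -- Coefficients of minus the total gain as a combination of `𝟙` and the `f i`, the form required
  -- by `positive`.
  loss : Vector Carrier k → Vector Carrier (suc k)
  loss σ = (- (σ ∙ b)) Vector.∷ σ

  𝟙∷f : Vector 𝐀.Carrier (suc k)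
  𝟙∷f = 𝐀.𝟙 Vector.∷ f

  loss-∙ : ∀ σ μ → loss σ ∙ (value μ ∘ 𝟙∷f) ≈ - (σ ∙ gain μ)
  loss-∙ σ μ = begin-equality
    - (σ ∙ b) * mass μ + σ ∙ (value μ ∘ f)
      ≈⟨ solve 3 (λ s m t → (:- s) :* m :+ t := :- (m :* s :- t)) refl (σ ∙ b) (mass μ) _ ⟩
    - (mass μ * (σ ∙ b) - σ ∙ (value μ ∘ f))
      ≈⟨ -‿cong (+-cong (∙-*-homoʳ (mass μ) σ b) (∙-neg-homoʳ σ (value μ ∘ f))) ⟨
    - (σ ∙ (λ i → mass μ * b i) + σ ∙ (λ i → - value μ (f i)))
      ≈⟨ -‿cong (∙-distribˡ-+ σ (λ i → mass μ * b i) (λ i → - value μ (f i))) ⟨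
    - (σ ∙ gain μ) ∎

  gain-nonpos : ∀ σ → (∀ x → σ ∙ gain (evaluation x) ≤ 0#) → ∀ μ → σ ∙ gain μ ≤ 0#
  gain-nonpos σ ≤0 μ = 0≤-x⇒x≤0 (≤-respʳ-≈ (loss-∙ σ μ) (positive (loss σ) 𝟙∷f
    (λ x → ≤-respʳ-≈ (sym (loss-∙ σ (evaluation x))) (x≤0⇒0≤-x (≤0 x))) μ))

  -- Without a positive gain the loss is nonnegative at all points and positive at `x₀`, hence
  -- strictly positive under `s`. But `s` extends the book, so its gain is zero.
  faithful⇒coherent : (s : State 𝐀) → Faithful s → (∀ i → State.value s (f i) ≈ b i) → Coherent
  faithful⇒coherent s faithful extends σ (x₀ , gain<0) = case em of λ
    { (yes positive-gain)   → positive-gain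
    ; (no no-positive-gain) → contradiction
        (sym (trans (loss-∙ σ μ) (trans (-‿cong gain≈0) -0≈0)))
        (proj₂ (0<loss no-positive-gain)) }
    where
    μ = stateMeasure s

    0<loss : ¬ (∃ λ x → 0# < σ ∙ gain (evaluation x)) → 0# < loss σ ∙ (value μ ∘ 𝟙∷f)
    0<loss no-positive-gain = strictly-positive (loss σ) 𝟙∷f
      (λ x → ≤-respʳ-≈ (sym (loss-∙ σ (evaluation x))) (x≤0⇒0≤-x (case ≤-or-> _ _ of λ
        { (inj₁ gain≤0) → gain≤0
        ; (inj₂ 0<gain) → contradiction (x , 0<gain) no-positive-gain })))
      x₀ (<-resp-≈ refl (sym (loss-∙ σ (evaluation x₀))) (x<0⇒0<-x gain<0)) μ faithful

    gain≈0 : σ ∙ gain μ ≈ 0#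
    gain≈0 = trans
      -- Zero is written as `0# * 0#` so that homogeneity pulls out a zero factor.
      (∙-congʳ σ {gain μ} {λ _ → 0# * 0#} (λ i → begin-equality
        mass μ * b i - value μ (f i)
          ≈⟨ +-cong (*-congʳ (State.normalised s)) (-‿cong (extends i)) ⟩
        1# * b i - b i                ≈⟨ +-congʳ (*-identityˡ (b i)) ⟩
        b i - b i                     ≈⟨ -‿inverseʳ (b i) ⟩
        0#                            ≈⟨ zeroˡ 0# ⟨
        0# * 0#                       ∎))
      (trans (∙-*-homoʳ 0# σ (λ _ → 0#)) (zeroˡ _))

  -- If `σ` is nonnegative on all gains, coherence for `- σ` excludes positive ones, so all vanish.
  -- Then `gain-nonpos` for `σ` and `- σ` makes the gain of `μ` vanish too.
  unseparated : Coherent → ∀ μ → Unseparated (gain ∘ evaluation) (λ i → - gain μ i)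
  unseparated coherent μ σ nonneg =
    gain≈0 , trans (∙-neg-homoʳ σ (gain μ)) (trans (-‿cong μ-gain≈0) -0≈0)
    where
    -σ : Vector Carrier k
    -σ i = - σ i

    gain≤0 : ∀ x → σ ∙ gain (evaluation x) ≤ 0#
    gain≤0 x with ≤-or-> (σ ∙ gain (evaluation x)) 0#
    ... | inj₁ ≤0 = ≤0
    ... | inj₂ 0<g =
      let x′ , 0<-g′ = coherent -σ (x , 0<-x⇒x<0 (<-resp-≈ refl
            (trans (sym (-‿involutive _))
                   (-‿cong (sym (∙-neg-homoˡ σ (gain (evaluation x)))))) 0<g))
      in contradiction (nonneg x′)
           (<⇒≱ (0<-x⇒x<0 (<-resp-≈ refl (∙-neg-homoˡ σ (gain (evaluation x′))) 0<-g′)))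

    gain≈0 : ∀ x → σ ∙ gain (evaluation x) ≈ 0#
    gain≈0 x = antisym (gain≤0 x) (nonneg x)

    μ-gain≈0 : σ ∙ gain μ ≈ 0#
    μ-gain≈0 = antisym (gain-nonpos σ gain≤0 μ) (≤-respˡ-≈ -0≈0 (≤-respʳ-≈ (-‿involutive _)
      (-‿anti-≤ (≤-respˡ-≈ (∙-neg-homoˡ σ (gain μ)) (gain-nonpos -σ
        (λ x → ≤-reflexive (trans (∙-neg-homoˡ σ (gain (evaluation x)))
                                  (trans (-‿cong (gain≈0 x)) -0≈0))) μ)))))

  -- The vector `w` is the discrepancy of `μ` from the book. Adding `r` times the evaluation at `x`
  -- removes the summand `r * gain` from it. Measures only grow, which preserves faithfulness.
  correct : ∀ {w} → Cone (gain ∘ evaluation) w → ∀ μ →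
    (∀ i → value μ (f i) ≈ mass μ * b i + w i) →
    ∃ λ ν → (∀ a → value μ a ≤ value ν a) × (∀ i → value ν (f i) ≈ mass ν * b i)
  correct (vertex w≈0) μ μf≈ =
    μ , (λ _ → ≤-refl) , λ i → trans (μf≈ i) (trans (+-congˡ (w≈0 i)) (+-identityʳ _))
  correct {w} (step {w′ = w′} r x 0≤r w≈ rest) μ μf≈ =
    let ν , μ′≤ν , νf≈ = correct rest (μ +ₘ scale r 0≤r (evaluation x)) μ′f≈
    in ν , (λ a → ≤-trans (x≤x+y (*-nonneg 0≤r (Measure.nonneg (evaluation x) a))) (μ′≤ν a)) , νf≈
    where
    e = evaluation x
    μ′f≈ : ∀ i → value μ (f i) + r * value e (f i) ≈ (mass μ + r * mass e) * b i + w′ i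
    μ′f≈ i = trans (+-congʳ (trans (μf≈ i) (+-congˡ (w≈ i))))
      (solve 6 (λ m b r n v w → (m :* b :+ (r :* (n :* b :- v) :+ w)) :+ r :* v
                             := (m :+ r :* n) :* b :+ w)
             refl (mass μ) (b i) r (mass e) (value e (f i)) (w′ i))

  coherent⇒faithful : (μ : Measure) → 0# < mass μ → (∀ a → ¬ a 𝐀.≈ 𝐀.𝟘 → 0# < value μ a) →
    Coherent → ∃ λ (s : State 𝐀) → Faithful s × (∀ i → State.value s (f i) ≈ b i)
  coherent⇒faithful μ 0<mass μ-faithful coherent = s , s-faithful , λ i →
    *-cancelˡ-≉0 (pos⇒≉0 0<massν) (trans (νs≈ν (f i)) (νf≈ i))
    where
    corrected = correct
      (unseparated⇒∈Cone k (gain ∘ evaluation) (λ i → - gain μ i) (unseparated coherent μ)) μ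
      (λ i → solve 2 (λ p q → q := p :+ (:- (p :- q))) refl (mass μ * b i) (value μ (f i)))
    ν = proj₁ corrected
    μ≤ν = proj₁ (proj₂ corrected)
    νf≈ = proj₂ (proj₂ corrected)
    0<massν = <-≤-trans 0<mass (μ≤ν 𝐀.𝟙)
    s = proj₁ (normalise ν 0<massν)
    νs≈ν = proj₂ (normalise ν 0<massν)

    s-faithful : Faithful s
    s-faithful a a≉𝟘 sa≈0 = <⇒≱ (<-≤-trans (μ-faithful a a≉𝟘) (μ≤ν a))
      (≤-reflexive (trans (sym (νs≈ν a)) (trans (*-congˡ sa≈0) (zeroʳ _))))

-- Series with weights 1/2, 1/4, 1/8 and so on.

module GeometricSeries (em : ExcludedMiddle 0ℓ) (ℝ : CompleteOrderedField) where

  open CompleteOrderedField ℝ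
  open OrderedFieldProperties ℝ
  open CompleteOrderedFieldProperties em ℝ
  open McNaughtonFunctions ℝ using (𝕀)
  open ≤-Reasoning

  ½ : Carrier
  ½ = proj₁ (half 0<1)

  0<½ : 0# < ½
  0<½ = proj₁ (proj₂ (half 0<1))

  ½*[1+1]≈1 : ½ * (1# + 1#) ≈ 1#
  ½*[1+1]≈1 = trans (distribˡ ½ 1# 1#)
    (trans (+-cong (*-identityʳ ½) (*-identityʳ ½)) (proj₂ (proj₂ (half 0<1))))

  -- partialSum m h = Σ_{j<m} h j / 2^{j+1}
  partialSum : ℕ → (ℕ → 𝕀) → Carrier
  partialSum zero    h = 0#
  partialSum (suc m) h = ½ * (proj₁ (h 0) + partialSum m (h ∘ suc))

  partialSum-nonneg : ∀ m h → 0# ≤ partialSum m h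
  partialSum-nonneg zero    h = ≤-refl
  partialSum-nonneg (suc m) h =
    *-nonneg (proj₁ 0<½) (+-nonneg (proj₁ (proj₂ (h 0))) (partialSum-nonneg m (h ∘ suc)))

  partialSum≤1 : ∀ m h → partialSum m h ≤ 1#
  partialSum≤1 zero    h = 0≤1
  partialSum≤1 (suc m) h = ≤-respʳ-≈ ½*[1+1]≈1
    (*-monoʳ-≤-nonneg (proj₁ 0<½) (+-mono-≤ (proj₂ (proj₂ (h 0))) (partialSum≤1 m (h ∘ suc))))

  partialSum-mono-+ : ∀ m j h → partialSum m h ≤ partialSum (m ℕ.+ j) h
  partialSum-mono-+ zero    j h = partialSum-nonneg j h
  partialSum-mono-+ (suc m) j h =
    *-monoʳ-≤-nonneg (proj₁ 0<½) (+-monoʳ-≤ _ (partialSum-mono-+ m j (h ∘ suc)))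

  partialSum-cong : ∀ m {g h} → (∀ j → proj₁ (g j) ≈ proj₁ (h j)) → partialSum m g ≈ partialSum m h
  partialSum-cong zero    g≈h = refl
  partialSum-cong (suc m) g≈h = *-congˡ (+-cong (g≈h 0) (partialSum-cong m (g≈h ∘ suc)))

  partialSum-+ : ∀ m {f g h} → (∀ j → proj₁ (h j) ≈ proj₁ (f j) + proj₁ (g j)) →
                 partialSum m h ≈ partialSum m f + partialSum m g
  partialSum-+ zero    h≈f+g = sym (+-identityˡ 0#)
  partialSum-+ (suc m) h≈f+g = trans
    (*-congˡ (+-cong (h≈f+g 0) (partialSum-+ m (h≈f+g ∘ suc))))
    (solve 5 (λ k a b c d → k :* ((a :+ b) :+ (c :+ d)) := k :* (a :+ c) :+ k :* (b :+ d))
           refl ½ _ _ _ _)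

  partialSum-pos : ∀ j h → 0# < proj₁ (h j) → 0# < partialSum (suc j) h
  partialSum-pos zero    h 0<h = *-pos 0<½ (<-resp-≈ refl (sym (+-identityʳ _)) 0<h)
  partialSum-pos (suc j) h 0<h = *-pos 0<½ (<-≤-trans (partialSum-pos j (h ∘ suc) 0<h)
    (≤-respʳ-≈ (+-comm _ _) (x≤x+y (proj₁ (proj₂ (h 0))))))

  module _ (h : ℕ → 𝕀) where
    private
      IsPartialSum : Carrier → Set
      IsPartialSum r = ∃ λ m → r ≈ partialSum m h

      limit = supremum IsPartialSum (0# , 0 , refl)
        (1# , λ { (m , r≈) → ≤-respˡ-≈ (sym r≈) (partialSum≤1 m h) })

    seriesSum : Carrier
    seriesSum = proj₁ limit

    partialSum≤seriesSum : ∀ m → partialSum m h ≤ seriesSum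
    partialSum≤seriesSum m = proj₁ (proj₂ limit) (m , refl)

    seriesSum-least : ∀ {u} → (∀ m → partialSum m h ≤ u) → seriesSum ≤ u
    seriesSum-least ≤u = proj₂ (proj₂ limit) λ { (m , r≈) → ≤-respˡ-≈ (sym r≈) (≤u m) }

  series : (ℕ → 𝕀) → 𝕀
  series h = seriesSum h , partialSum≤seriesSum h 0 , seriesSum-least h (λ m → partialSum≤1 m h)

  series-mono : ∀ {g h} → (∀ j → proj₁ (g j) ≈ proj₁ (h j)) → seriesSum g ≤ seriesSum h
  series-mono {g} {h} g≈h = seriesSum-least g (λ m →
    ≤-respˡ-≈ (sym (partialSum-cong m g≈h)) (partialSum≤seriesSum h m))

  series-cong : ∀ {g h} → (∀ j → proj₁ (g j) ≈ proj₁ (h j)) → seriesSum g ≈ seriesSum h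
  series-cong {g} {h} g≈h =
    antisym (series-mono {g} {h} g≈h) (series-mono {h} {g} (λ j → sym (g≈h j)))

  -- For the second inequality, partial sums of lengths `m` and `l` are both extended to length
  -- `m + l`; the two suprema are then taken one after the other.
  series-+ : ∀ {f g h} → (∀ j → proj₁ (h j) ≈ proj₁ (f j) + proj₁ (g j)) →
             seriesSum h ≈ seriesSum f + seriesSum g
  series-+ {f} {g} {h} h≈f+g = antisym
    (seriesSum-least h (λ m → ≤-respˡ-≈ (sym (partialSum-+ m h≈f+g))
      (+-mono-≤ (partialSum≤seriesSum f m) (partialSum≤seriesSum g m))))
    (x≤z-y⇒x+y≤z (seriesSum-least f (λ m → x+y≤z⇒x≤z-y (≤-respˡ-≈ (+-comm _ _)
      (x≤z-y⇒x+y≤z (seriesSum-least g (λ l → x+y≤z⇒x≤z-y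
        (≤-respˡ-≈ (+-comm _ _) (partials m l)))))))))
    where
    partials : ∀ m l → partialSum m f + partialSum l g ≤ seriesSum h
    partials m l = begin
      partialSum m f + partialSum l g
        ≤⟨ +-mono-≤ (partialSum-mono-+ m l f)
             (≤-respʳ-≈ (reflexive (≡.cong (λ j → partialSum j g) (ℕ.+-comm l m)))
                        (partialSum-mono-+ l m g)) ⟩
      partialSum (m ℕ.+ l) f + partialSum (m ℕ.+ l) g
        ≈⟨ partialSum-+ (m ℕ.+ l) h≈f+g ⟨
      partialSum (m ℕ.+ l) h
        ≤⟨ partialSum≤seriesSum h (m ℕ.+ l) ⟩
      seriesSum h ∎

  series-pos : ∀ h j → 0# < proj₁ (h j) → 0# < seriesSum h
  series-pos h j 0<h = <-≤-trans (partialSum-pos j h 0<h) (partialSum≤seriesSum h (suc j))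

-- A faithful measure charging a countable dense set of points.

module DenseMeasure (em : ExcludedMiddle 0ℓ) (ℝ : CompleteOrderedField) where

  open CompleteOrderedField ℝ
  open OrderedFieldProperties ℝ
  open CompleteOrderedFieldProperties em ℝ
  open McNaughtonFunctions ℝ
  open GeometricSeries em ℝ
  open ≤-Reasoning

  -- Integration against the product measure that gives every point `q ∘ a` positive weight.
  average : ∀ n → (ℕ → 𝕀) → (Point n → 𝕀) → 𝕀
  average zero    q h = h Vector.[]
  average (suc n) q h = series (λ a → average n q (λ p → h (q a Vector.∷ p)))

  average-cong : ∀ n q {g h} → (∀ p → proj₁ (g p) ≈ proj₁ (h p)) →
                 proj₁ (average n q g) ≈ proj₁ (average n q h)
  average-cong zero    q g≈h = g≈h _
  average-cong (suc n) q g≈h = series-cong (λ a → average-cong n q (λ p → g≈h _))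

  average-+ : ∀ n q {f g h} → (∀ p → proj₁ (h p) ≈ proj₁ (f p) + proj₁ (g p)) →
              proj₁ (average n q h) ≈ proj₁ (average n q f) + proj₁ (average n q g)
  average-+ zero    q h≈f+g = h≈f+g _
  average-+ (suc n) q h≈f+g = series-+ (λ a → average-+ n q (λ p → h≈f+g _))

  -- Congruence of `h` is assumed because `q ∘ a` and the vector built coordinate by coordinate
  -- agree only pointwise.
  average-pos : ∀ n q (h : Point n → 𝕀) →
    (∀ {x y} → (∀ i → proj₁ (x i) ≈ proj₁ (y i)) → proj₁ (h x) ≈ proj₁ (h y)) →
    (a : Vector ℕ n) → 0# < proj₁ (h (q ∘ a)) → 0# < proj₁ (average n q h)
  average-pos zero    q h h-cong a 0<h = <-resp-≈ refl (h-cong (λ ())) 0<h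
  average-pos (suc n) q h h-cong a 0<h = series-pos _ (a Fin.zero)
    (average-pos n q (λ p → h (q (a Fin.zero) Vector.∷ p))
      (λ x≈y → h-cong λ { Fin.zero → refl ; (Fin.suc i) → x≈y i })
      (tail a)
      (<-resp-≈ refl (h-cong λ { Fin.zero → refl ; (Fin.suc i) → refl }) 0<h))

  0<suc·1 : ∀ l → 0# < suc l · 1#
  0<suc·1 l = <-≤-trans 0<1 (x≤x+y (·1-nonneg l))

  mesh : ℕ → Carrier
  mesh l = proj₁ (inverse-pos (0<suc·1 l))

  -- The multiples of 1/(l + 1), cut off at 1 so that `a` may range over all naturals.
  grid : ℕ → ℕ → 𝕀
  grid l a = 1# ⊓ (a · 1# * mesh l)
    , ⊓-glb 0≤1 (*-nonneg (·1-nonneg a) (proj₁ (proj₁ (proj₂ (inverse-pos (0<suc·1 l))))))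
    , x⊓y≤x _ _

  -- The mesh is made smaller than `δ` and `x` is rounded down to a multiple of it. One `l` serves
  -- all `x`, hence all coordinates of a point at once.
  grid-dense : ∀ {δ} → 0# < δ → ∃ λ l → ∀ (x : 𝕀) → ∃ λ a → ∣ proj₁ x - proj₁ (grid l a) ∣ < δ
  grid-dense {δ} 0<δ = l , near
    where
    bound = archimedean-pos 0<δ 1#
    l = proj₁ bound
    N = suc l · 1#
    r = mesh l
    0≤r = proj₁ (proj₁ (proj₂ (inverse-pos (0<suc·1 l))))
    Nr≈1 = proj₂ (proj₂ (inverse-pos (0<suc·1 l)))

    r<δ : r < δ
    r<δ with ≤-or-> δ r
    ... | inj₂ r<δ = r<δ
    ... | inj₁ δ≤r = contradiction (begin
      l · 1# * δ    ≤⟨ *-monoˡ-≤-nonneg (proj₁ 0<δ) (≤-respʳ-≈ (+-comm _ _) (x≤x+y 0≤1)) ⟩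
      N * δ         ≤⟨ *-monoʳ-≤-nonneg (proj₁ (0<suc·1 l)) δ≤r ⟩
      N * r         ≈⟨ Nr≈1 ⟩
      1#            ∎) (<⇒≱ (proj₂ bound))

    near : ∀ (x : 𝕀) → ∃ λ a → ∣ proj₁ x - proj₁ (grid l a) ∣ < δ
    near (x , 0≤x , x≤1) = a , x<y+ε∧y<x+ε⇒∣x-y∣<ε
      (≤-<-trans x≤ar+r (<-resp-≈ refl (+-congʳ (sym grid≈ar)) (+-monoʳ-< _ r<δ)))
      (≤-<-trans (≤-respˡ-≈ (sym grid≈ar) ar≤x) (x<x+y 0<δ))
      where
      rounded = floor (x * N) (*-nonneg 0≤x (proj₁ (0<suc·1 l)))
      a = proj₁ rounded

      xNr≈x : x * N * r ≈ x
      xNr≈x = trans (*-assoc x N r) (trans (*-congˡ Nr≈1) (*-identityʳ x))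

      ar≤x : a · 1# * r ≤ x
      ar≤x = ≤-respʳ-≈ xNr≈x (*-monoˡ-≤-nonneg 0≤r (proj₁ (proj₂ rounded)))

      x≤ar+r : x ≤ a · 1# * r + r
      x≤ar+r = ≤-respˡ-≈ xNr≈x (≤-respʳ-≈
        (trans (distribʳ r 1# (a · 1#)) (trans (+-congʳ (*-identityˡ r)) (+-comm r _)))
        (*-monoˡ-≤-nonneg 0≤r (proj₁ (proj₂ (proj₂ rounded)))))

      grid≈ar : 1# ⊓ (a · 1# * r) ≈ a · 1# * r
      grid≈ar = x≥y⇒x⊓y≈y (≤-trans ar≤x x≤1)

  module _ (n : ℕ) where

    open Measures em ℝ (𝐅 n)
    open MVAlgebraProperties (𝐅 n)
    private
      module 𝐅 = MVAlgebra (𝐅 n)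

    evaluation : Point n → Measure
    evaluation x = record
      { value    = λ f → McNaughton.function f at x
      ; cong     = λ f≈g → f≈g x
      ; nonneg   = λ f → proj₁ (proj₂ (McNaughton.to f x))
      -- Disjointness means that the sum is at most 1 at `x`, so the truncation in `⊕` has no
      -- effect.
      ; additive = λ f g f⊙g≈𝟘 → x≥y⇒x⊓y≈y (f+g≤1 f g (f⊙g≈𝟘 x))
      }
      where
      f+g≤1 : ∀ f g → McNaughton.function (f 𝐅.⊙ g) at x ≈ 0# →
              McNaughton.function f at x + McNaughton.function g at x ≤ 1#
      f+g≤1 f g f⊙g≈0 = 0≤y-x⇒x≤y (≤-respʳ-≈
        (solve 2 (λ s o → :- (s :- o) := o :- s) refl _ _)
        (x≤0⇒0≤-x (≤-respʳ-≈
          (trans (sym (standard-⊙ (McNaughton.to f x) (McNaughton.to g x))) f⊙g≈0)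
          (x≤y⊔x _ _))))

    x≤y⇒x⊖y≈0 : ∀ f g x → McNaughton.function f at x ≤ McNaughton.function g at x →
                McNaughton.function (f ⊖ g) at x ≈ 0#
    x≤y⇒x⊖y≈0 f g x f≤g = trans
      (+-congˡ (-‿cong (x≤y⇒x⊓y≈x (≤-respˡ-≈
        (solve 2 (λ o a → (o :- a) :+ a := o) refl 1# _) (+-monoʳ-≤ _ f≤g)))))
      (-‿inverseʳ 1#)

    evaluations : SeparatingFamily
    evaluations = record
      { Index      = Point n
      ; evaluation = evaluation
      ; separating = λ _ f≈0 → f≈0
      ; linear     = λ f g x →
          case total (McNaughton.function f at x) (McNaughton.function g at x) of λ
          { (inj₁ f≤g) → inj₁ (x≤y⇒x⊖y≈0 f g x f≤g)
          ; (inj₂ g≤f) → inj₂ (x≤y⇒x⊖y≈0 g f x g≤f) }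
      }

    denseMeasure : Measure
    denseMeasure = record
      { value    = λ f → proj₁ (integral f)
      ; cong     = λ f≈g → series-cong (λ l → average-cong n (grid l) f≈g)
      ; nonneg   = λ f → proj₁ (proj₂ (integral f))
      ; additive = λ f g f⊙g≈𝟘 → series-+ (λ l → average-+ n (grid l)
          (λ p → Measure.additive (evaluation p) f g f⊙g≈𝟘))
      }
      where
      integral : McNaughton n → 𝕀
      integral f = series (λ l → average n (grid l) (McNaughton.to f))

    -- A nonzero function is positive at some point, by continuity also at a nearby grid point, and
    -- that grid point has positive weight.
    denseMeasure-faithful : ∀ f → ¬ f 𝐅.≈ 𝐅.𝟘 → 0# < value denseMeasure f
    denseMeasure-faithful f f≉𝟘 = cases em
      where
      support : ∀ x → 0# < McNaughton.function f at x → 0# < value denseMeasure f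
      support x 0<fx = series-pos _ l
        (average-pos n (grid l) (McNaughton.to f) (McNaughton.cong f) a 0<fa)
        where
        -- The tolerance is the value of `f` at `x` itself, which keeps `f` positive within the
        -- resulting distance.
        continuity = McNaughton.continuous f x _ 0<fx
        density = grid-dense (proj₁ (proj₂ continuity))
        l = proj₁ density
        a : Vector ℕ n
        a i = proj₁ (proj₂ density (x i))
        0<fa : 0# < McNaughton.function f at (grid l ∘ a)
        0<fa = <-resp-≈ (-‿inverseʳ _) (solve 2 (λ p q → (p :+ q) :- q := p) refl _ _)
          (+-monoˡ-< (- (McNaughton.function f at x)) (∣x-y∣<ε⇒x<y+ε
            (proj₂ (proj₂ continuity) (grid l ∘ a) (λ i → proj₂ (proj₂ density (x i))))))

      cases : Dec (∃ λ x → McNaughton.function f at x ≉ 0#) → 0# < value denseMeasure f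
      cases (yes (x , fx≉0)) = support x
        (proj₁ (proj₂ (McNaughton.to f x)) , λ 0≈fx → fx≉0 (sym 0≈fx))
      cases (no vanishes) = contradiction (λ x → case em {McNaughton.function f at x ≈ 0#} of λ
        { (yes fx≈0) → fx≈0
        ; (no fx≉0)  → contradiction (x , fx≉0) vanishes }) f≉𝟘

-- The equivalence for books on McNaughton functions.

open import Data.Nat.Base using (_≤_)

theorem4p8 : ExcludedMiddle 0ℓ → (ℝ : CompleteOrderedField) →
    let open McNaughtonFunctions ℝ in
    (n : ℕ) → 1 ≤ n → (k : ℕ) (f : Vector (McNaughton n) k) (β : Book f) →
    StrictlyCoherent f β ⇔ (∃ λ (s : State (𝐅 n)) → Faithful s × Extends f s β)
theorem4p8 em ℝ n _ k f β = mk⇔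
  (λ strict → coherent⇒faithful (denseMeasure n) 0<mass (denseMeasure-faithful n)
                                 (strictlyCoherent⇒coherent strict))
  (λ (s , faithful , extends) → coherent⇒strictlyCoherent (faithful⇒coherent s faithful extends))
  where
  open CompleteOrderedField ℝ
  open OrderedFieldProperties ℝ
  open CompleteOrderedFieldProperties em ℝ
  open McNaughtonFunctions ℝ
  open DenseMeasure em ℝ
  open Measures em ℝ (𝐅 n)

  b : Vector Carrier k
  b i = proj₁ (Func.to β i)

  open Coherence em ℝ (𝐅 n) (evaluations n) f b

  -- A point evaluation has mass `1# - 0#`, so the factor in the gain disappears.
  gain≈balance : ∀ σ x → σ ∙ gain (evaluation n x) ≈ balance f β σ x
  gain≈balance σ x = ∙-congʳ σ (λ i → +-congʳ (trans (*-congʳ standard-𝟙) (*-identityˡ (b i))))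

  strictlyCoherent⇒coherent : StrictlyCoherent f β → Coherent
  strictlyCoherent⇒coherent strict σ (x , gain<0) =
    let x′ , 0<balance = strict σ (x , <-resp-≈ (gain≈balance σ x) refl gain<0)
    in x′ , <-resp-≈ refl (sym (gain≈balance σ x′)) 0<balance

  coherent⇒strictlyCoherent : Coherent → StrictlyCoherent f β
  coherent⇒strictlyCoherent coherent σ (x , balance<0) =
    let x′ , 0<gain = coherent σ (x , <-resp-≈ (sym (gain≈balance σ x)) refl balance<0)
    in x′ , <-resp-≈ refl (gain≈balance σ x′) 0<gain

  0<mass : 0# < mass (denseMeasure n)
  0<mass = denseMeasure-faithful n (MVAlgebra.𝟙 (𝐅 n)) λ 𝟙≈𝟘 →
    -- Any point refutes `𝟙 ≈ 𝟘`; the one with all coordinates `grid 0 0` is at hand.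
    0#≉1# (trans (sym (𝟙≈𝟘 (λ _ → grid 0 0))) standard-𝟙)
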